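{- Let $n$ and $\ell$ be positive integers with $\ell\leqslant\frac{n}{2}$, and let $G=K_\ell\cup K_{n-\ell}$ be the graph on $n$ vertices consisting of two complete components $K_\ell$ and $K_{n-\ell}$, so that it has $m=\binom{\ell}{2}+\binom{n-\ell}{2}$ edges. Assume $$\ell-\frac{2\ell^2}{n}\leqslant 1.$$ Then $G=K_\ell\cup K_{n-\ell}$ is a Largest Eigenvalue Global Minimizer (LEGM).
   Context: All graphs are simple, undirected and unweighted (no self loops, no multiple edges). The Laplacian of $G$ is $L(G)=D(G)-A(G)$, where $D(G)$ is the diagonal matrix of vertex degrees and $A(G)$ is the adjacency matrix; $\lambda_1(G)$ denotes the largest eigenvalue of $L(G)$. $K_r$ is the complete graph on $r$ vertices and $\cup$ denotes disjoint union of graphs. A graph $G$ with $n$ vertices and $m$ edges is a Largest Eigenvalue Global Minimizer (LEGM) if $\lambda_1(G)\leqslant\lambda_1(H)$ for every simple graph $H$ with $n$ vertices and $m$ edges. -}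

module Defs where

open import Algebra.Apartness.Structures using (IsHeytingField)
open import Algebra.Bundles using (CommutativeRing)
import Algebra.Properties.CommutativeMonoid.Sum as Sum
import Algebra.Properties.Monoid.Mult as Mult
open import Data.Bool.Base using (Bool; false; not; _∧_; if_then_else_)
open import Data.Fin.Base using (Fin; splitAt)
open import Data.Fin.Properties using (_≟_; _<?_)
open import Data.Nat.Base as ℕ using (ℕ)
open import Data.Nat.Properties using (+-0-commutativeMonoid)
open import Data.Product.Base using (Σ-syntax; ∃-syntax; _×_)
open import Data.Sum.Base using (_⊎_; inj₁; inj₂)
open import Data.Vec.Functional using (Vector)
open import Level using (Level; suc; _⊔_)
open import Relation.Binary.Core using (Rel)
open import Relation.Binary.PropositionalEquality using (_≡_; refl; sym)
open import Relation.Binary.Structures using (IsStrictPartialOrder)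
open import Relation.Nullary.Decidable using (yes; no; ⌊_⌋)
open import Relation.Nullary.Negation using (¬_; contradiction)

private
  variable
    a b n : ℕ

-- A constructive ordered field: apartness is x < y or y < x, and neither
-- trichotomy nor decidability of the order is assumed.
record OrderedField (c ℓ₁ ℓ₂ : Level) : Set (suc (c ⊔ ℓ₁ ⊔ ℓ₂)) where
  infix  8 -_
  infixl 7 _*_
  infixl 6 _+_
  infix  4 _≈_ _<_ _#_ _≤_
  field
    Carrier : Set c
    _≈_     : Rel Carrier ℓ₁
    _<_     : Rel Carrier ℓ₂
    _+_     : Carrier → Carrier → Carrier
    _*_     : Carrier → Carrier → Carrier
    -_      : Carrier → Carrier
    0#      : Carrier
    1#      : Carrier

  _#_ : Rel Carrier ℓ₂
  x # y = x < y ⊎ y < x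

  _≤_ : Rel Carrier ℓ₂
  x ≤ y = ¬ (y < x)

  field
    isHeytingField         : IsHeytingField _≈_ _#_ _+_ _*_ -_ 0# 1#
    <-isStrictPartialOrder : IsStrictPartialOrder _≈_ _<_
    +-monoˡ-<              : ∀ {x y} z → x < y → (x + z) < (y + z)
    *-pos                  : ∀ {x y} → 0# < x → 0# < y → 0# < (x * y)

  open IsHeytingField isHeytingField public

  commutativeRing : CommutativeRing c ℓ₁
  commutativeRing = record { isCommutativeRing = isCommutativeRing }

  open CommutativeRing commutativeRing public
    using (+-monoid; +-commutativeMonoid)

  fromℕ : ℕ → Carrier
  fromℕ k = k · 1#
    where open Mult +-monoid renaming (_×_ to _·_) using ()

  -- No absolute value is needed here, since i and j range symmetrically.
  IsCauchy : (ℕ → Carrier) → Set (c ⊔ ℓ₂)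
  IsCauchy u = ∀ ε → 0# < ε →
    ∃[ N ] (∀ i j → N ℕ.≤ i → N ℕ.≤ j → (u i - u j) < ε)

  ConvergesTo : (ℕ → Carrier) → Carrier → Set (c ⊔ ℓ₂)
  ConvergesTo u x = ∀ ε → 0# < ε →
    ∃[ N ] (∀ i → N ℕ.≤ i → (u i - x) < ε × (x - u i) < ε)

-- The real numbers, axiomatised as a Cauchy-complete Archimedean ordered
-- field; classically this determines ℝ up to unique isomorphism.  Both the
-- classical reals and Bishop's constructive Cauchy reals are models.
record RealNumbers (c ℓ₁ ℓ₂ : Level) : Set (suc (c ⊔ ℓ₁ ⊔ ℓ₂)) where
  field
    orderedField : OrderedField c ℓ₁ ℓ₂

  open OrderedField orderedField public

  field
    archimedean : ∀ x → ∃[ k ] x < fromℕ k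
    complete    : ∀ u → IsCauchy u → ∃[ x ] ConvergesTo u x

record Graph (n : ℕ) : Set where
  field
    adj        : Fin n → Fin n → Bool
    adj-sym    : ∀ i j → adj i j ≡ adj j i
    adj-irrefl : ∀ i → adj i i ≡ false

open Graph public

K : ∀ r → Graph r
K r = record
  { adj        = λ i j → not ⌊ i ≟ j ⌋
  ; adj-sym    = adj-sym′
  ; adj-irrefl = adj-irrefl′
  }
  where
  adj-sym′ : ∀ (i j : Fin r) → not ⌊ i ≟ j ⌋ ≡ not ⌊ j ≟ i ⌋
  adj-sym′ i j with i ≟ j | j ≟ i
  ... | yes _   | yes _   = refl
  ... | no _    | no _    = refl
  ... | yes i≡j | no j≢i  = contradiction (sym i≡j) j≢i
  ... | no i≢j  | yes j≡i = contradiction (sym j≡i) i≢j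

  adj-irrefl′ : ∀ (i : Fin r) → not ⌊ i ≟ i ⌋ ≡ false
  adj-irrefl′ i with i ≟ i
  ... | yes _  = refl
  ... | no i≢i = contradiction refl i≢i

infixr 6 _∪_

-- Disjoint union: the first a vertices carry G and the last b carry H.
_∪_ : Graph a → Graph b → Graph (a ℕ.+ b)
_∪_ {a} {b} G H = record
  { adj        = λ i j → adj⊎ (splitAt a i) (splitAt a j)
  ; adj-sym    = λ i j → sym⊎ (splitAt a i) (splitAt a j)
  ; adj-irrefl = λ i → irrefl⊎ (splitAt a i)
  }
  where
  adj⊎ : Fin a ⊎ Fin b → Fin a ⊎ Fin b → Bool
  adj⊎ (inj₁ i) (inj₁ j) = adj G i j
  adj⊎ (inj₂ i) (inj₂ j) = adj H i j
  adj⊎ (inj₁ _) (inj₂ _) = false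
  adj⊎ (inj₂ _) (inj₁ _) = false

  sym⊎ : ∀ x y → adj⊎ x y ≡ adj⊎ y x
  sym⊎ (inj₁ i) (inj₁ j) = adj-sym G i j
  sym⊎ (inj₂ i) (inj₂ j) = adj-sym H i j
  sym⊎ (inj₁ _) (inj₂ _) = refl
  sym⊎ (inj₂ _) (inj₁ _) = refl

  irrefl⊎ : ∀ x → adj⊎ x x ≡ false
  irrefl⊎ (inj₁ i) = adj-irrefl G i
  irrefl⊎ (inj₂ i) = adj-irrefl H i

module ℕSum = Sum +-0-commutativeMonoid

degree : Graph n → Fin n → ℕ
degree G i = ℕSum.sum λ j → if adj G i j then 1 else 0

-- Each edge {i, j} is counted once, as the pair with i < j.
numEdges : Graph n → ℕ
numEdges G = ℕSum.sum λ i → ℕSum.sum λ j →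
  if ⌊ i <? j ⌋ ∧ adj G i j then 1 else 0

module Spectrum {c ℓ₁ ℓ₂} (ℝ : RealNumbers c ℓ₁ ℓ₂) where
  open RealNumbers ℝ
  open Sum +-commutativeMonoid using (sum)

  Matrix : ℕ → Set c
  Matrix n = Fin n → Fin n → Carrier

  degreeMatrix : Graph n → Matrix n
  degreeMatrix G i j = if ⌊ i ≟ j ⌋ then fromℕ (degree G i) else 0#

  adjacencyMatrix : Graph n → Matrix n
  adjacencyMatrix G i j = if adj G i j then 1# else 0#

  laplacian : Graph n → Matrix n
  laplacian G i j = degreeMatrix G i j - adjacencyMatrix G i j

  IsEigenvalue : Matrix n → Carrier → Set (c ⊔ ℓ₁)
  IsEigenvalue {n} M μ = Σ[ v ∈ Vector Carrier n ]
    ¬ (∀ i → v i ≈ 0#) × (∀ i → sum (λ j → M i j * v j) ≈ μ * v i)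

  IsLargestEigenvalue : Matrix n → Carrier → Set (c ⊔ ℓ₁ ⊔ ℓ₂)
  IsLargestEigenvalue M μ = IsEigenvalue M μ × (∀ ν → IsEigenvalue M ν → ν ≤ μ)

  -- λ₁ as a relation: a largest eigenvalue is unique up to ≈, and for n ≥ 1
  -- the symmetric matrix laplacian G has one by the spectral theorem.
  λ₁[_]≈_ : Graph n → Carrier → Set (c ⊔ ℓ₁ ⊔ ℓ₂)
  λ₁[ G ]≈ μ = IsLargestEigenvalue (laplacian G) μ

  LEGM : Graph n → Set (c ⊔ ℓ₁ ⊔ ℓ₂)
  LEGM {n} G = ∀ (H : Graph n) → numEdges H ≡ numEdges G →
    ∀ {x y} → λ₁[ G ]≈ x → λ₁[ H ]≈ y → x ≤ y

{-# OPTIONS --safe #-}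
module Submission where

-- λ₁(K_ℓ ∪ K_r) ≤ r for r = n - ℓ ≥ ℓ, since k|v|² - q(v) = (Σ v)² on a component K_k.
-- For H with as many edges, the Rayleigh quotient of L e_u shows λ₁(H) ≥ deg u + 1 if deg u > 0,
-- so only graphs with all degrees ≤ r - 2 matter.  Comparing degree sums, the assumption then
-- forces H to be (r - 2)-regular and (ℓ - 1)(r - ℓ - 2) = 2, i.e. H is 4-regular on n = 8 or 9
-- vertices and r = 6.  The complement of H is cubic on 8 vertices, hence contains a triangle or
-- a 4-cycle, or is quartic on 9 vertices, hence contains a triangle; the vertex set S of such a
-- cycle gives the test vector n·1_S - |S|·1, whose Rayleigh quotient is at least 6.
--
-- That λ₁ bounds Rayleigh quotients needs the existence of an eigenvalue: cotransitivity of <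
-- and Gaussian elimination bracket the supremum of the Rayleigh quotient by a Cauchy sequence,
-- and at its limit t the semidefinite form t|v|² - q(v) cannot be definite, so it has a kernel.

open import Defs
open import Algebra.Apartness.Bundles using (HeytingCommutativeRing)
import Algebra.Apartness.Properties.HeytingCommutativeRing as HeytingProperties
open import Algebra.Bundles using (CommutativeMonoid; CommutativeRing)
import Algebra.Properties.CommutativeMonoid.Sum as MonoidSum
import Algebra.Properties.Ring as RingProperties
import Algebra.Properties.Semiring.Mult as SemiringMult
import Algebra.Properties.Semiring.Mult.TCOptimised as SemiringMultOpt
import Algebra.Properties.Semiring.Sum as SemiringSum
import Algebra.Solver.Ring as RingSolver
open import Algebra.Solver.Ring.AlmostCommutativeRing using (fromCommutativeRing; _-Raw-AlmostCommutative⟶_)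
open import Data.Bool.Base using (Bool; true; false; not; _∧_; if_then_else_)
open import Data.Empty using (⊥; ⊥-elim)
open import Data.Fin.Base using (Fin; zero; suc; _↑ˡ_; _↑ʳ_)
open import Data.Fin.Patterns using (0F; 1F; 2F; 3F)
open import Data.Fin.Properties using (_≟_; _<?_; any?; splitAt-↑ˡ; splitAt-↑ʳ; <-cmp; suc-injective; 0≢1+n)
open import Data.Integer.Base as ℤ using (ℤ; -[1+_])
import Data.Integer.Properties as ℤₚ
import Data.Integer.Solver as ℤ-Solver
open import Data.Maybe.Base using (Maybe; just; nothing)
open import Data.Nat.Base as ℕ using (ℕ; zero; suc; z≤n; s≤s; NonZero)
import Data.Nat.Properties as ℕₚ
open import Data.Nat.Solver using (module +-*-Solver)
open import Data.Product.Base using (∃-syntax; _×_; _,_; proj₁; proj₂)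
open import Data.Sum.Base using (_⊎_; inj₁; inj₂; [_,_]′)
open import Data.Vec.Functional using (Vector; tail; head; _∷_)
open import Function.Base using (_∘_; case_of_)
open import Relation.Binary.Definitions using (tri<; tri≈; tri>)
open import Relation.Binary.PropositionalEquality as ≡ using (_≡_; _≢_)
import Relation.Binary.Reasoning.Setoid as SetoidReasoning
open import Relation.Binary.Structures using (IsStrictPartialOrder)
open import Relation.Nullary.Decidable using (yes; no; ⌊_⌋; from-yes)
open import Relation.Nullary.Negation using (¬_; contradiction)

-- For H with all degrees at most r - 2, comparing degree sums gives ℓ² + ℓ + r ≤ ℓr, while the
-- assumption, cleared of its denominator, is exactly the reverse inequality; this is why everything
-- is forced. The Rayleigh quotient of n·1_S - |S|·1 is n times the number of edges leaving S,
-- divided by |S| (n - |S|). In the two exceptional cases it reaches 6 with no room to spare, so S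
-- has to be chosen according to n: on 9 vertices a 4-cycle of the complement guarantees only
-- 9·12/20 < 6, and a triangle is required. The other obstacle is constructive. `λ₁[ H ]≈ y` says
-- only that `y` is an eigenvalue dominating all eigenvalues, and the order cannot be decided. Since
-- `x ≤ y` is a negation, it is enough that the limit t is an eigenvalue up to double negation, so
-- exact elimination may be run with `⊥` as its goal. The Cauchy sequence, in contrast, consists of
-- data, and its elimination must work with a positive tolerance.

module FiniteSums {c ℓ} (M : CommutativeMonoid c ℓ) where
  open CommutativeMonoid M
  open MonoidSum M using (sum; sum-cong-≋; sum-replicate-zero)

  sum-single : ∀ {n} (t : Vector Carrier n) i → (∀ j → i ≢ j → t j ≈ ε) → sum t ≈ t i
  sum-single {suc n} t zero    t≈ε =
    trans (∙-congˡ (trans (sum-cong-≋ (λ j → t≈ε (suc j) 0≢1+n)) (sum-replicate-zero n))) (identityʳ _)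
  sum-single {suc n} t (suc i) t≈ε =
    trans (∙-cong (t≈ε zero (0≢1+n ∘ ≡.sym)) (sum-single (tail t) i (λ j i≢j → t≈ε (suc j) (i≢j ∘ suc-injective))))
      (identityˡ _)

  sum-select : ∀ {n} i (t : Vector Carrier n) → sum (λ j → if ⌊ i ≟ j ⌋ then t j else ε) ≈ t i
  sum-select i t = trans (sum-single _ i off) diag
    where
    off : ∀ j → i ≢ j → (if ⌊ i ≟ j ⌋ then t j else ε) ≈ ε
    off j i≢j with i ≟ j
    ... | yes i≡j = contradiction i≡j i≢j
    ... | no _    = refl

    diag : (if ⌊ i ≟ i ⌋ then t i else ε) ≈ t i
    diag with i ≟ i
    ... | yes _  = refl
    ... | no i≢i = contradiction ≡.refl i≢i

  sum-split : ∀ a {b} (t : Vector Carrier (a ℕ.+ b)) → sum t ≈ sum (t ∘ (_↑ˡ b)) ∙ sum (t ∘ (a ↑ʳ_))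
  sum-split zero    t = sym (identityˡ _)
  sum-split (suc a) t = trans (∙-congˡ (sum-split a (tail t))) (sym (assoc _ _ _))

-- Arithmetic and order in a constructive ordered field.

module OrderedFieldProperties {c ℓ₁ ℓ₂} (F : OrderedField c ℓ₁ ℓ₂) where
  open OrderedField F hiding (zero) public
  open CommutativeRing commutativeRing public
    using (ring; semiring)
  open SetoidReasoning setoid public
  open IsStrictPartialOrder <-isStrictPartialOrder public
    using () renaming (irrefl to <-irrefl; trans to <-trans; <-respʳ-≈ to <-respʳ; <-respˡ-≈ to <-respˡ)
  open RingProperties ring public using (-0#≈0#)
  open SemiringSum semiring public
    using (sum; sum-cong-≋; ∑-distrib-+; ∑-comm; *-distribˡ-sum; *-distribʳ-sum; sum-replicate; sum-replicate-zero)

  -- Normalisation compares coefficients, and equality in the field is undecidable; hence the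
  -- coefficients are integers, mapped into the field by `⟦_⟧ᶻ`.
  module IntegerSolver where
    open import Data.Integer.Base using (+_)
    open SemiringMultOpt semiring using (×-homo-+; ×1-homo-*) renaming (_×_ to _·_)
    open RingProperties ring using (-‿+-comm; -‿involutive; -‿distribˡ-*; -‿distribʳ-*)

    ⟦_⟧ᶻ : ℤ → Carrier
    ⟦ + n ⟧ᶻ      = n · 1#
    ⟦ -[1+ n ] ⟧ᶻ = - (suc n · 1#)

    -ᶻ-homo : ∀ i → ⟦ ℤ.- i ⟧ᶻ ≈ - ⟦ i ⟧ᶻ
    -ᶻ-homo (+ zero)   = sym -0#≈0#
    -ᶻ-homo (+ suc n)  = refl
    -ᶻ-homo -[1+ n ]   = sym (-‿involutive _)

    ⊖-homo : ∀ m n → ⟦ m ℤ.⊖ n ⟧ᶻ ≈ m · 1# - n · 1#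
    ⊖-homo m n with ℕₚ.≤-total n m
    ... | inj₁ n≤m = begin
      ⟦ m ℤ.⊖ n ⟧ᶻ               ≡⟨ ≡.cong ⟦_⟧ᶻ (ℤₚ.⊖-≥ n≤m) ⟩
      k · 1#                     ≈⟨ sym (+-identityʳ _) ⟩
      k · 1# + 0#                ≈⟨ +-congˡ (sym (-‿inverseʳ _)) ⟩
      k · 1# + (n · 1# - n · 1#) ≈⟨ sym (+-assoc _ _ _) ⟩
      k · 1# + n · 1# - n · 1#   ≈⟨ +-congʳ (sym (×-homo-+ 1# k n)) ⟩
      (k ℕ.+ n) · 1# - n · 1#    ≡⟨ ≡.cong (λ j → j · 1# - n · 1#) (ℕₚ.m∸n+n≡m n≤m) ⟩
      m · 1# - n · 1#            ∎
      where k = m ℕ.∸ n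
    ... | inj₂ m≤n = begin
      ⟦ m ℤ.⊖ n ⟧ᶻ               ≡⟨ ≡.cong ⟦_⟧ᶻ (ℤₚ.⊖-≤ m≤n) ⟩
      ⟦ ℤ.- (+ k) ⟧ᶻ             ≈⟨ -ᶻ-homo (+ k) ⟩
      - (k · 1#)                 ≈⟨ sym (+-identityˡ _) ⟩
      0# - k · 1#                ≈⟨ +-congʳ (sym (-‿inverseʳ _)) ⟩
      m · 1# - m · 1# - k · 1#   ≈⟨ +-assoc _ _ _ ⟩
      m · 1# + (- (m · 1#) - k · 1#) ≈⟨ +-congˡ (-‿+-comm _ _) ⟩
      m · 1# - (m · 1# + k · 1#) ≈⟨ +-congˡ (-‿cong (sym (×-homo-+ 1# m k))) ⟩
      m · 1# - (m ℕ.+ k) · 1#    ≡⟨ ≡.cong (λ j → m · 1# - j · 1#) (ℕₚ.m+[n∸m]≡n m≤n) ⟩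
      m · 1# - n · 1#            ∎
      where k = n ℕ.∸ m

    +ᶻ-homo : ∀ i j → ⟦ i ℤ.+ j ⟧ᶻ ≈ ⟦ i ⟧ᶻ + ⟦ j ⟧ᶻ
    +ᶻ-homo (+ m)    (+ n)    = ×-homo-+ 1# m n
    +ᶻ-homo (+ m)    -[1+ n ] = ⊖-homo m (suc n)
    +ᶻ-homo -[1+ m ] (+ n)    = trans (⊖-homo n (suc m)) (+-comm _ _)
    +ᶻ-homo -[1+ m ] -[1+ n ] = begin
      - (suc (suc (m ℕ.+ n)) · 1#)      ≡⟨ ≡.cong (λ j → - (j · 1#)) (≡.sym (≡.cong suc (ℕₚ.+-suc m n))) ⟩
      - ((suc m ℕ.+ suc n) · 1#)        ≈⟨ -‿cong (×-homo-+ 1# (suc m) (suc n)) ⟩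
      - (suc m · 1# + suc n · 1#)       ≈⟨ sym (-‿+-comm _ _) ⟩
      - (suc m · 1#) - suc n · 1#       ∎

    *ᶻ-homo : ∀ i j → ⟦ i ℤ.* j ⟧ᶻ ≈ ⟦ i ⟧ᶻ * ⟦ j ⟧ᶻ
    *ᶻ-homo (+ m)    (+ n)    = begin
      ⟦ + m ℤ.* + n ⟧ᶻ ≡⟨ ≡.cong ⟦_⟧ᶻ (≡.sym (ℤₚ.pos-* m n)) ⟩
      (m ℕ.* n) · 1#   ≈⟨ ×1-homo-* m n ⟩
      m · 1# * n · 1#  ∎
    *ᶻ-homo (+ m)    -[1+ n ] = begin
      ⟦ + m ℤ.* -[1+ n ] ⟧ᶻ           ≡⟨ ≡.cong ⟦_⟧ᶻ (≡.sym (ℤₚ.neg-distribʳ-* (+ m) (+ suc n))) ⟩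
      ⟦ ℤ.- (+ m ℤ.* + suc n) ⟧ᶻ      ≈⟨ -ᶻ-homo (+ m ℤ.* + suc n) ⟩
      - ⟦ + m ℤ.* + suc n ⟧ᶻ          ≈⟨ -‿cong (*ᶻ-homo (+ m) (+ suc n)) ⟩
      - (m · 1# * suc n · 1#)         ≈⟨ -‿distribʳ-* _ _ ⟩
      m · 1# * - (suc n · 1#)         ∎
    *ᶻ-homo -[1+ m ] (+ n)    = begin
      ⟦ -[1+ m ] ℤ.* + n ⟧ᶻ           ≡⟨ ≡.cong ⟦_⟧ᶻ (≡.sym (ℤₚ.neg-distribˡ-* (+ suc m) (+ n))) ⟩
      ⟦ ℤ.- (+ suc m ℤ.* + n) ⟧ᶻ      ≈⟨ -ᶻ-homo (+ suc m ℤ.* + n) ⟩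
      - ⟦ + suc m ℤ.* + n ⟧ᶻ          ≈⟨ -‿cong (*ᶻ-homo (+ suc m) (+ n)) ⟩
      - (suc m · 1# * n · 1#)         ≈⟨ -‿distribˡ-* _ _ ⟩
      - (suc m · 1#) * n · 1#         ∎
    *ᶻ-homo -[1+ m ] -[1+ n ] = begin
      (suc m ℕ.* suc n) · 1#           ≈⟨ ×1-homo-* (suc m) (suc n) ⟩
      suc m · 1# * suc n · 1#          ≈⟨ sym (-‿involutive _) ⟩
      - - (suc m · 1# * suc n · 1#)    ≈⟨ -‿cong (-‿distribʳ-* _ _) ⟩
      - (suc m · 1# * - (suc n · 1#))  ≈⟨ -‿distribˡ-* _ _ ⟩
      - (suc m · 1#) * - (suc n · 1#)  ∎

    morphism : ℤ.+-*-rawRing -Raw-AlmostCommutative⟶ fromCommutativeRing commutativeRing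
    morphism = record
      { ⟦_⟧    = ⟦_⟧ᶻ
      ; +-homo = +ᶻ-homo
      ; *-homo = *ᶻ-homo
      ; -‿homo = -ᶻ-homo
      ; 0-homo = refl
      ; 1-homo = refl
      }

    _coeff≟_ : ∀ i j → Maybe (⟦ i ⟧ᶻ ≈ ⟦ j ⟧ᶻ)
    i coeff≟ j with i ℤₚ.≟ j
    ... | yes ≡.refl = just refl
    ... | no  _      = nothing

    open RingSolver ℤ.+-*-rawRing (fromCommutativeRing commutativeRing) morphism _coeff≟_ public
      using (Polynomial; solve; con; _:+_; _:*_; _:-_; :-_; _:=_)

    #1 #2 #0 : ∀ {n} → Polynomial n
    #0 = con (+ 0)
    #1 = con (+ 1)
    #2 = con (+ 2)

    -- Unary, so that it evaluates to the very expression that `fromℕ k` unfolds to.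
    numeral : ∀ {n} → ℕ → Polynomial n
    numeral zero    = #0
    numeral (suc k) = #1 :+ numeral k

  open IntegerSolver public using (solve; _:+_; _:*_; _:-_; :-_; _:=_; #0; #1; #2; numeral)

  heytingCommutativeRing : HeytingCommutativeRing c ℓ₁ ℓ₂
  heytingCommutativeRing = record { isHeytingCommutativeRing = isHeytingCommutativeRing }

  open HeytingProperties heytingCommutativeRing using (1#0)

  private
    variable
      x y z e : Carrier
      n : ℕ

  -- Cotransitivity of apartness offers four alternatives, which transitivity merges into two. This
  -- replaces trichotomy wherever a disjunction has to be produced rather than refuted.
  <-cotrans : x < y → ∀ z → x < z ⊎ z < y
  <-cotrans x<y z with #-cotrans (inj₁ x<y) z
  ... | inj₁ (inj₁ x<z) = inj₁ x<z
  ... | inj₁ (inj₂ z<x) = inj₂ (<-trans z<x x<y)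
  ... | inj₂ (inj₁ z<y) = inj₂ z<y
  ... | inj₂ (inj₂ y<z) = inj₁ (<-trans x<y y<z)

  <⇒≤ : x < y → x ≤ y
  <⇒≤ x<y y<x = <-irrefl refl (<-trans x<y y<x)

  ≤-reflexive : x ≈ y → x ≤ y
  ≤-reflexive x≈y = <-irrefl (sym x≈y)

  ≤-trans : x ≤ y → y ≤ z → x ≤ z
  ≤-trans {y = y} x≤y y≤z z<x with <-cotrans z<x y
  ... | inj₁ z<y = y≤z z<y
  ... | inj₂ y<x = x≤y y<x

  ≤-<-trans : x ≤ y → y < z → x < z
  ≤-<-trans {x} x≤y y<z with <-cotrans y<z x
  ... | inj₁ y<x = contradiction y<x x≤y
  ... | inj₂ x<z = x<z

  <-≤-trans : x < y → y ≤ z → x < z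
  <-≤-trans {z = z} x<y y≤z with <-cotrans x<y z
  ... | inj₁ x<z = x<z
  ... | inj₂ z<y = contradiction z<y y≤z

  ≤-antisym : x ≤ y → y ≤ x → x ≈ y
  ≤-antisym x≤y y≤x = proj₁ (tight _ _) λ { (inj₁ x<y) → y≤x x<y ; (inj₂ y<x) → x≤y y<x }

  ≤-resp : x ≈ y → 0# ≤ x → 0# ≤ y
  ≤-resp x≈y 0≤x y<0 = 0≤x (<-respˡ (sym x≈y) y<0)

  <⇒0<- : x < y → 0# < y - x
  <⇒0<- {x} {y} x<y = <-respˡ (-‿inverseʳ x) (+-monoˡ-< (- x) x<y)

  0<⇒< : 0# < e → e ≈ y - x → x < y
  0<⇒< {e} {y} {x} 0<e e≈y-x =
    <-respʳ (solve 2 (λ x y → y :- x :+ x := y) refl x y)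
      (<-respˡ (+-identityˡ x) (+-monoˡ-< x (<-respʳ e≈y-x 0<e)))

  ≤⇒0≤- : x ≤ y → 0# ≤ y - x
  ≤⇒0≤- {x} {y} x≤y y-x<0 = x≤y
    (<-respʳ (+-identityˡ x) (<-respˡ (solve 2 (λ x y → y :- x :+ x := y) refl x y) (+-monoˡ-< x y-x<0)))

  0≤⇒≤ : 0# ≤ e → e ≈ y - x → x ≤ y
  0≤⇒≤ {e} {y} {x} 0≤e e≈y-x y<x =
    0≤e (<-respˡ (sym e≈y-x) (<-respʳ (-‿inverseʳ x) (+-monoˡ-< (- x) y<x)))

  +-pos : 0# < x → 0# < y → 0# < x + y
  +-pos {x} {y} 0<x 0<y = <-trans 0<y (<-respˡ (+-identityˡ y) (+-monoˡ-< y 0<x))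

  +-pos-nonneg : 0# < x → 0# ≤ y → 0# < x + y
  +-pos-nonneg {x} {y} 0<x 0≤y = ≤-<-trans 0≤y (<-respˡ (+-identityˡ y) (+-monoˡ-< y 0<x))

  +-nonneg : 0# ≤ x → 0# ≤ y → 0# ≤ x + y
  +-nonneg {x} {y} 0≤x 0≤y x+y<0 with <-cotrans x+y<0 y
  ... | inj₂ y<0   = 0≤y y<0
  ... | inj₁ x+y<y = 0≤⇒≤ 0≤x (solve 2 (λ x y → x := x :+ y :- y) refl x y) x+y<y

  -- Order statements are negations, so they may be proved by trichotomy.
  trichotomy : ∀ x → ¬ ¬ (x < 0# ⊎ x ≈ 0# ⊎ 0# < x)
  trichotomy x ¬tri = ¬tri (inj₂ (inj₁ (≤-antisym
    (λ 0<x → ¬tri (inj₂ (inj₂ 0<x))) (λ x<0 → ¬tri (inj₁ x<0)))))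

  *-nonneg : 0# ≤ x → 0# ≤ y → 0# ≤ x * y
  *-nonneg {x} {y} 0≤x 0≤y xy<0 = trichotomy x λ where
    (inj₁ x<0)        → 0≤x x<0
    (inj₂ (inj₁ x≈0)) → <-irrefl (trans (*-congʳ x≈0) (zeroˡ y)) xy<0
    (inj₂ (inj₂ 0<x)) → trichotomy y λ where
      (inj₁ y<0)        → 0≤y y<0
      (inj₂ (inj₁ y≈0)) → <-irrefl (trans (*-congˡ y≈0) (zeroʳ x)) xy<0
      (inj₂ (inj₂ 0<y)) → <⇒≤ (*-pos 0<x 0<y) xy<0

  x<0⇒0<-x : x < 0# → 0# < - x
  x<0⇒0<-x {x} x<0 = <-respʳ (+-identityˡ (- x)) (<⇒0<- x<0)

  square-nonneg : ∀ x → 0# ≤ x * x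
  square-nonneg x xx<0 = trichotomy x λ where
    (inj₁ x<0) → <⇒≤ (<-respʳ (solve 1 (λ x → :- x :* :- x := x :* x) refl x)
                        (*-pos (x<0⇒0<-x x<0) (x<0⇒0<-x x<0))) xx<0
    (inj₂ (inj₁ x≈0)) → <-irrefl (trans (*-congʳ x≈0) (zeroˡ x)) xx<0
    (inj₂ (inj₂ 0<x)) → <⇒≤ (*-pos 0<x 0<x) xx<0

  0<1 : 0# < 1#
  0<1 with 1#0
  ... | inj₂ 0<1′ = 0<1′
  ... | inj₁ 1<0  = contradiction 1<0 (≤-resp (*-identityˡ 1#) (square-nonneg 1#))

  1≉0 : ¬ 1# ≈ 0#
  1≉0 1≈0 = <-irrefl (sym 1≈0) 0<1

  nonneg-cancelˡ : 0# < x → 0# ≤ x * y → 0# ≤ y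
  nonneg-cancelˡ {x} {y} 0<x 0≤xy y<0 = 0≤xy
    (0<⇒< (*-pos 0<x (x<0⇒0<-x y<0)) (solve 2 (λ x y → x :* :- y := #0 :- x :* y) refl x y))

  reciprocal : 0# < x → ∃[ x⁻¹ ] (0# < x⁻¹ × x * x⁻¹ ≈ 1#)
  reciprocal {x} 0<x with #⇒invertible (inj₂ 0<x)
  ... | x⁻¹ , _ , [x-0]x⁻¹≈1 = x⁻¹ , 0<x⁻¹ , xx⁻¹≈1
    where
    xx⁻¹≈1 : x * x⁻¹ ≈ 1#
    xx⁻¹≈1 = trans (solve 2 (λ x y → x :* y := (x :- #0) :* y) refl x x⁻¹) [x-0]x⁻¹≈1

    0<x⁻¹ : 0# < x⁻¹
    0<x⁻¹ with invertible⇒# {x⁻¹} {0#}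
      ( x
      , trans (solve 2 (λ x y → x :* (y :- #0) := x :* y) refl x x⁻¹) xx⁻¹≈1
      , trans (solve 2 (λ x y → (y :- #0) :* x := x :* y) refl x x⁻¹) xx⁻¹≈1 )
    ... | inj₂ 0<x⁻¹′ = 0<x⁻¹′
    ... | inj₁ x⁻¹<0  = contradiction
      (≤-<-trans (≤-reflexive (sym xx⁻¹≈1))
        (0<⇒< (*-pos 0<x (x<0⇒0<-x x⁻¹<0)) (solve 2 (λ x y → x :* :- y := #0 :- x :* y) refl x x⁻¹)))
      (<⇒≤ 0<1)

  module _ where
    open SemiringMult semiring using (×-homo-+; ×1-homo-*)

    fromℕ-+ : ∀ m n → fromℕ (m ℕ.+ n) ≈ fromℕ m + fromℕ n
    fromℕ-+ = ×-homo-+ 1#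

    fromℕ-* : ∀ m n → fromℕ (m ℕ.* n) ≈ fromℕ m * fromℕ n
    fromℕ-* = ×1-homo-*

  fromℕ-cong : ∀ {m n} → m ≡ n → fromℕ m ≈ fromℕ n
  fromℕ-cong ≡.refl = refl

  fromℕ-nonneg : ∀ n → 0# ≤ fromℕ n
  fromℕ-nonneg zero    = ≤-reflexive refl
  fromℕ-nonneg (suc n) = +-nonneg (<⇒≤ 0<1) (fromℕ-nonneg n)

  fromℕ-pos : ∀ n → 0# < fromℕ (suc n)
  fromℕ-pos n = +-pos-nonneg 0<1 (fromℕ-nonneg n)

  fromℕ-mono-≤ : ∀ {m n} → m ℕ.≤ n → fromℕ m ≤ fromℕ n
  fromℕ-mono-≤ {m} {n} m≤n = 0≤⇒≤ (fromℕ-nonneg (n ℕ.∸ m)) (begin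
    fromℕ (n ℕ.∸ m)                       ≈⟨ solve 2 (λ x y → x := (x :+ y) :- y) refl _ (fromℕ m) ⟩
    fromℕ (n ℕ.∸ m) + fromℕ m - fromℕ m   ≈⟨ +-congʳ (sym (fromℕ-+ (n ℕ.∸ m) m)) ⟩
    fromℕ (n ℕ.∸ m ℕ.+ m) - fromℕ m       ≡⟨ ≡.cong (λ k → fromℕ k - fromℕ m) (ℕₚ.m∸n+n≡m m≤n) ⟩
    fromℕ n - fromℕ m                     ∎)

  sum-nonneg : {t : Vector Carrier n} → (∀ i → 0# ≤ t i) → 0# ≤ sum t
  sum-nonneg {zero}  _   = ≤-reflexive refl
  sum-nonneg {suc n} 0≤t = +-nonneg (0≤t zero) (sum-nonneg (0≤t ∘ suc))

  ≤-*-nonneg : 0# ≤ z → x ≤ y → x * z ≤ y * z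
  ≤-*-nonneg {z} {x} {y} 0≤z x≤y = 0≤⇒≤ (*-nonneg (≤⇒0≤- x≤y) 0≤z)
    (solve 3 (λ x y z → (y :- x) :* z := y :* z :- x :* z) refl x y z)

  sum-cong : {s t : Vector Carrier n} → (∀ i → s i ≈ t i) → sum s ≈ sum t
  sum-cong = sum-cong-≋

  square-zero : ∀ {x} → x * x ≤ 0# → x ≈ 0#
  square-zero {x} xx≤0 = ≤-antisym
    (λ 0<x → xx≤0 (*-pos 0<x 0<x))
    (λ x<0 → xx≤0 (<-respʳ (solve 1 (λ x → :- x :* :- x := x :* x) refl x) (*-pos (x<0⇒0<-x x<0) (x<0⇒0<-x x<0))))

  ≤-respˡ : ∀ {x y z} → x ≈ y → x ≤ z → y ≤ z
  ≤-respˡ x≈y x≤z z<y = x≤z (<-respʳ (sym x≈y) z<y)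

  ≤-respʳ : ∀ {x y z} → x ≈ y → z ≤ x → z ≤ y
  ≤-respʳ x≈y z≤x y<z = z≤x (<-respˡ (sym x≈y) y<z)

  +-mono-≤ : ∀ {x y u v} → x ≤ y → u ≤ v → x + u ≤ y + v
  +-mono-≤ {x} {y} {u} {v} x≤y u≤v = 0≤⇒≤ (+-nonneg (≤⇒0≤- x≤y) (≤⇒0≤- u≤v))
    (solve 4 (λ x y u v → y :- x :+ (v :- u) := y :+ v :- (x :+ u)) refl x y u v)

-- Quadratic forms, semidefinite kernels and Gaussian elimination.

module QuadraticForms {c ℓ₁ ℓ₂} (F : OrderedField c ℓ₁ ℓ₂) where
  open OrderedFieldProperties F
  open FiniteSums +-commutativeMonoid using (sum-single; sum-select; sum-split)

  private
    variable
      m n : ℕ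

  Matrix : ℕ → Set c
  Matrix n = Fin n → Fin n → Carrier

  Symmetric : Matrix n → Set ℓ₁
  Symmetric M = ∀ i j → M i j ≈ M j i

  Zero : Vector Carrier n → Set ℓ₁
  Zero v = ∀ i → v i ≈ 0#

  opaque
    dot : Vector Carrier n → Vector Carrier n → Carrier
    dot u v = sum λ i → u i * v i

    dot≈sum : (u v : Vector Carrier n) → dot u v ≈ sum (λ i → u i * v i)
    dot≈sum u v = refl

    dot-[] : (u v : Vector Carrier 0) → dot u v ≈ 0#
    dot-[] u v = refl

    dot-∷ : (u v : Vector Carrier (suc n)) → dot u v ≈ head u * head v + dot (tail u) (tail v)
    dot-∷ u v = refl

  normSq : Vector Carrier n → Carrier
  normSq v = dot v v

  apply : (Fin m → Vector Carrier n) → Vector Carrier n → Vector Carrier m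
  apply M v i = dot (M i) v

  form : Matrix n → Vector Carrier n → Vector Carrier n → Carrier
  form M u v = dot u (apply M v)

  quad : Matrix n → Vector Carrier n → Carrier
  quad M v = form M v v

  combine : Carrier → Vector Carrier n → Carrier → Vector Carrier n → Vector Carrier n
  combine a v b w i = a * v i + b * w i

  δ : Matrix n
  δ i j = if ⌊ i ≟ j ⌋ then 1# else 0#

  opaque
    unfolding dot

    dot-cong : {u u′ v v′ : Vector Carrier n} →
               (∀ i → u i ≈ u′ i) → (∀ i → v i ≈ v′ i) → dot u v ≈ dot u′ v′
    dot-cong u≈u′ v≈v′ = sum-cong λ i → *-cong (u≈u′ i) (v≈v′ i)

    dot-comm : (u v : Vector Carrier n) → dot u v ≈ dot v u
    dot-comm u v = sum-cong λ i → *-comm (u i) (v i)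

    dot-combineʳ : ∀ (u : Vector Carrier n) a v b w → dot u (combine a v b w) ≈ a * dot u v + b * dot u w
    dot-combineʳ u a v b w = begin
      sum (λ i → u i * (a * v i + b * w i))
        ≈⟨ sum-cong (λ i → solve 5 (λ u a v b w → u :* (a :* v :+ b :* w) := a :* (u :* v) :+ b :* (u :* w))
                             refl (u i) a (v i) b (w i)) ⟩
      sum (λ i → a * (u i * v i) + b * (u i * w i))
        ≈⟨ ∑-distrib-+ (λ i → a * (u i * v i)) (λ i → b * (u i * w i)) ⟩
      sum (λ i → a * (u i * v i)) + sum (λ i → b * (u i * w i))
        ≈⟨ +-cong (*-distribˡ-sum a (λ i → u i * v i)) (*-distribˡ-sum b (λ i → u i * w i)) ⟨
      a * dot u v + b * dot u w ∎

  dot-combineˡ : ∀ (u : Vector Carrier n) a v b w → dot (combine a v b w) u ≈ a * dot v u + b * dot w u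
  dot-combineˡ u a v b w = trans (dot-comm _ u)
    (trans (dot-combineʳ u a v b w) (+-cong (*-congˡ (dot-comm u v)) (*-congˡ (dot-comm u w))))

  normSq-combine : ∀ a (v : Vector Carrier n) b w →
    normSq (combine a v b w) ≈ a * a * normSq v + (1# + 1#) * (a * b) * dot v w + b * b * normSq w
  normSq-combine a v b w = begin
    normSq (combine a v b w)
      ≈⟨ dot-combineʳ _ a v b w ⟩
    a * dot (combine a v b w) v + b * dot (combine a v b w) w
      ≈⟨ +-cong (*-congˡ (dot-combineˡ v a v b w)) (*-congˡ (dot-combineˡ w a v b w)) ⟩
    a * (a * normSq v + b * dot w v) + b * (a * dot v w + b * normSq w)
      ≈⟨ +-congʳ (*-congˡ (+-congˡ (*-congˡ (dot-comm w v)))) ⟩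
    a * (a * normSq v + b * dot v w) + b * (a * dot v w + b * normSq w)
      ≈⟨ solve 5 (λ a b x y z → a :* (a :* x :+ b :* y) :+ b :* (a :* y :+ b :* z)
           := a :* a :* x :+ #2 :* (a :* b) :* y :+ b :* b :* z) refl a b _ _ _ ⟩
    a * a * normSq v + (1# + 1#) * (a * b) * dot v w + b * b * normSq w ∎

  opaque
    unfolding dot

    dot-δ : ∀ i (v : Vector Carrier n) → dot (δ i) v ≈ v i
    dot-δ i v = trans (sum-cong pointwise) (sum-select i v)
      where
      pointwise : ∀ j → δ i j * v j ≈ (if ⌊ i ≟ j ⌋ then v j else 0#)
      pointwise j with i ≟ j
      ... | yes _ = *-identityˡ _
      ... | no _  = zeroˡ _

  δ-diag : ∀ (i : Fin n) → δ i i ≈ 1#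
  δ-diag i with i ≟ i
  ... | yes _  = refl
  ... | no i≢i = contradiction ≡.refl i≢i

  δ-off : ∀ {i j : Fin n} → i ≢ j → δ i j ≈ 0#
  δ-off {i = i} {j} i≢j with i ≟ j
  ... | yes i≡j = contradiction i≡j i≢j
  ... | no _    = refl

  δ-sym : Symmetric (δ {n})
  δ-sym i j with i ≟ j | j ≟ i
  ... | yes _   | yes _   = refl
  ... | no _    | no _    = refl
  ... | yes i≡j | no j≢i  = contradiction (≡.sym i≡j) j≢i
  ... | no i≢j  | yes j≡i = contradiction (≡.sym j≡i) i≢j

  apply-δ : ∀ (M : Matrix n) i j → apply M (δ j) i ≈ M i j
  apply-δ M i j = trans (dot-comm (M i) (δ j)) (dot-δ j (M i))

  normSq-δ : ∀ (i : Fin n) → normSq (δ i) ≈ 1#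
  normSq-δ i = trans (dot-δ i (δ i)) (δ-diag i)

  quad-δ : ∀ (M : Matrix n) i → quad M (δ i) ≈ M i i
  quad-δ M i = trans (dot-δ i (apply M (δ i))) (apply-δ M i i)

  δ-nonzero : ∀ (i : Fin n) → ¬ Zero (δ i)
  δ-nonzero i δ≈0 = 1≉0 (trans (sym (δ-diag i)) (δ≈0 i))

  opaque
    unfolding dot

    form-comm : ∀ {M : Matrix n} → Symmetric M → ∀ u v → form M u v ≈ form M v u
    form-comm {M = M} M-sym u v = begin
      sum (λ i → u i * sum (λ j → M i j * v j))    ≈⟨ sum-cong (λ i → *-distribˡ-sum (u i) (λ j → M i j * v j)) ⟩
      sum (λ i → sum λ j → u i * (M i j * v j))    ≈⟨ ∑-comm (λ i j → u i * (M i j * v j)) ⟩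
      sum (λ j → sum λ i → u i * (M i j * v j))
        ≈⟨ sum-cong (λ j → sum-cong λ i → trans (*-congˡ (*-congʳ (M-sym i j)))
             (solve 3 (λ u a v → u :* (a :* v) := v :* (a :* u)) refl (u i) (M j i) (v j))) ⟩
      sum (λ j → sum λ i → v j * (M j i * u i))    ≈⟨ sum-cong (λ j → *-distribˡ-sum (v j) (λ i → M j i * u i)) ⟨
      sum (λ j → v j * sum (λ i → M j i * u i))    ∎

  form-combineʳ : ∀ (M : Matrix n) u a v b w →
    form M u (combine a v b w) ≈ a * form M u v + b * form M u w
  form-combineʳ M u a v b w =
    trans (dot-cong (λ _ → refl) (λ i → dot-combineʳ (M i) a v b w)) (dot-combineʳ u a _ b _)

  quad-combine : ∀ {M : Matrix n} → Symmetric M → ∀ a v b w →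
    quad M (combine a v b w) ≈ a * a * quad M v + (1# + 1#) * (a * b) * form M v w + b * b * quad M w
  quad-combine {M = M} M-sym a v b w = begin
    quad M x
      ≈⟨ form-combineʳ M x a v b w ⟩
    a * form M x v + b * form M x w
      ≈⟨ +-cong (*-congˡ (form-comm M-sym x v)) (*-congˡ (form-comm M-sym x w)) ⟩
    a * form M v x + b * form M w x
      ≈⟨ +-cong (*-congˡ (form-combineʳ M v a v b w)) (*-congˡ (form-combineʳ M w a v b w)) ⟩
    a * (a * quad M v + b * form M v w) + b * (a * form M w v + b * quad M w)
      ≈⟨ +-congˡ (*-congˡ (+-congʳ (*-congˡ (form-comm M-sym w v)))) ⟩
    a * (a * quad M v + b * form M v w) + b * (a * form M v w + b * quad M w)
      ≈⟨ solve 5 (λ a b x y z → a :* (a :* x :+ b :* y) :+ b :* (a :* y :+ b :* z)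
           := a :* a :* x :+ #2 :* (a :* b) :* y :+ b :* b :* z) refl a b _ _ _ ⟩
    a * a * quad M v + (1# + 1#) * (a * b) * form M v w + b * b * quad M w ∎
    where x = combine a v b w

  opaque
    unfolding dot

    normSq-nonneg : (v : Vector Carrier n) → 0# ≤ normSq v
    normSq-nonneg v = sum-nonneg λ i → square-nonneg (v i)

  normSq-∷ : (v : Vector Carrier (suc n)) → normSq v ≈ head v * head v + normSq (tail v)
  normSq-∷ v = dot-∷ v v

  normSq-zero : (v : Vector Carrier n) → normSq v ≤ 0# → Zero v
  normSq-zero {suc n} v |v|²≤0 = λ where
      zero    → square-zero (≤-trans (0≤⇒≤ (normSq-nonneg (tail v)) tail≈) |v|²≤0)
      (suc i) → normSq-zero (tail v) (≤-trans (0≤⇒≤ (square-nonneg (head v)) head≈) |v|²≤0) i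
    where
    tail≈ : normSq (tail v) ≈ normSq v - head v * head v
    tail≈ = trans (solve 2 (λ a b → b := a :+ b :- a) refl (head v * head v) (normSq (tail v))) (+-congʳ (sym (normSq-∷ v)))
    head≈ : head v * head v ≈ normSq v - normSq (tail v)
    head≈ = trans (solve 2 (λ a b → a := a :+ b :- b) refl (head v * head v) (normSq (tail v))) (+-congʳ (sym (normSq-∷ v)))

  -- Rests on (bx + d)² ≤ 2(bx)² + 2d². The constant is crude; any positive one serves the induction
  -- in `dot-bound`.
  square-sum-bound : ∀ {b x d B X} → d * d ≤ B * X → 0# ≤ X → 0# < B →
    (b * x + d) * (b * x + d) ≤ (B + B + (1# + (b * b + b * b))) * (x * x + X)
  square-sum-bound {b} {x} {d} {B} {X} d²≤BX 0≤X 0<B =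
    0≤⇒≤ (+-nonneg (+-nonneg (+-nonneg (square-nonneg (b * x - d))
                     (+-nonneg (≤⇒0≤- d²≤BX) (≤⇒0≤- d²≤BX)))
               (*-nonneg (<⇒≤ (+-pos (+-pos 0<B 0<B) 0<1)) (square-nonneg x)))
               (*-nonneg (+-nonneg (<⇒≤ 0<1) (+-nonneg (square-nonneg b) (square-nonneg b))) 0≤X))
        (solve 5 (λ b x d B X →
             (b :* x :- d) :* (b :* x :- d) :+ ((B :* X :- d :* d) :+ (B :* X :- d :* d)) :+ (B :+ B :+ #1) :* (x :* x)
               :+ (#1 :+ (b :* b :+ b :* b)) :* X
             := (B :+ B :+ (#1 :+ (b :* b :+ b :* b))) :* (x :* x :+ X) :- (b :* x :+ d) :* (b :* x :+ d))
          refl b x d B X)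

  -- Cauchy-Schwarz with some constant in place of |b|², by induction on the dimension.
  dot-bound : (b : Vector Carrier n) → ∃[ B ] (0# < B × ∀ x → dot b x * dot b x ≤ B * normSq x)
  dot-bound {zero}  b = 1# , 0<1 , λ x → ≤-respʳ (*-congˡ (sym (dot-[] x x)))
    (≤-reflexive (trans (*-congʳ (dot-[] b x)) (trans (zeroˡ _) (sym (zeroʳ 1#)))))
  dot-bound {suc n} b = let B , 0<B , bound = dot-bound (tail b) in
      B + B + (1# + (head b * head b + head b * head b))
    , +-pos (+-pos 0<B 0<B) (+-pos-nonneg 0<1 (+-nonneg (square-nonneg (head b)) (square-nonneg (head b))))
    , λ x → ≤-respˡ (sym (*-cong (dot-∷ b x) (dot-∷ b x))) (≤-respʳ (*-congˡ (sym (normSq-∷ x)))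
        (square-sum-bound (bound (tail x)) (normSq-nonneg (tail x)) 0<B))

  apply-bound : (M : Fin m → Vector Carrier n) → ∃[ C ] (0# < C × ∀ x → normSq (apply M x) ≤ C * normSq x)
  apply-bound {zero}  M = 1# , 0<1 , λ x → ≤-respˡ (sym (dot-[] (apply M x) (apply M x)))
    (*-nonneg (<⇒≤ 0<1) (normSq-nonneg x))
  apply-bound {suc m} M =
    let B , 0<B , bound  = dot-bound (head M)
        C , 0<C , bounds = apply-bound (tail M)
    in B + C , +-pos 0<B 0<C , λ x →
      ≤-respˡ (sym (normSq-∷ (apply M x))) (≤-respʳ (sym (distribʳ (normSq x) B C)) (+-mono-≤ (bound x) (bounds x)))

  young : ∀ (v w : Vector Carrier n) → dot v w + dot v w ≤ normSq v + normSq w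
  young v w = 0≤⇒≤ (normSq-nonneg (combine 1# v (- 1#) w)) (trans (normSq-combine 1# v (- 1#) w)
    (solve 3 (λ a b c → #1 :* #1 :* a :+ #2 :* (#1 :* :- #1) :* b :+ :- #1 :* :- #1 :* c
       := a :+ c :- (b :+ b)) refl (normSq v) (dot v w) (normSq w)))

  quad-bound-scalar : ∀ {q X Y C} → q + q ≤ X + Y → Y ≤ C * X → 0# < C → 0# ≤ X → q ≤ (1# + C) * X
  quad-bound-scalar {q} {X} {Y} {C} 2q≤X+Y Y≤CX 0<C 0≤X =
    0≤⇒≤ (nonneg-cancelˡ (+-pos 0<1 0<1)
            (≤-resp (solve 4 (λ C X Y q → (X :+ Y :- (q :+ q)) :+ (C :* X :- Y) :+ X :+ C :* X
                        := #2 :* ((#1 :+ C) :* X :- q)) refl C X Y q)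
              (+-nonneg (+-nonneg (+-nonneg (≤⇒0≤- 2q≤X+Y) (≤⇒0≤- Y≤CX)) 0≤X) (*-nonneg (<⇒≤ 0<C) 0≤X))))
      refl

  -- From 2⟨x, Mx⟩ ≤ |x|² + |Mx|². It bounds the Rayleigh quotient from above, which limits the
  -- later search, and supplies the constant in `psd-kernel`.
  quad-bound : (M : Matrix n) → ∃[ C ] (0# < C × ∀ x → quad M x ≤ C * normSq x)
  quad-bound M = let C , 0<C , bound = apply-bound M in
    1# + C , +-pos 0<1 0<C , λ x → quad-bound-scalar (young x (apply M x)) (bound x) 0<C (normSq-nonneg x)

  psd-kernel-scalar : ∀ {C q W r} → 0# < C → q ≤ 0# → r ≤ C * W →
    0# ≤ C * C * q + (1# + 1#) * (C * - 1#) * W + (- 1# * - 1#) * r → W ≤ 0#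
  psd-kernel-scalar {C} {q} {W} {r} 0<C q≤0 r≤CW 0≤Q =
    0≤⇒≤ (nonneg-cancelˡ {y = 0# - W} 0<C (≤-resp combined
      (+-nonneg (+-nonneg 0≤Q (*-nonneg (*-nonneg (<⇒≤ 0<C) (<⇒≤ 0<C)) (≤⇒0≤- q≤0))) (≤⇒0≤- r≤CW)))) refl
    where
    combined : C * C * q + (1# + 1#) * (C * - 1#) * W + (- 1# * - 1#) * r + C * C * (0# - q) + (C * W - r)
             ≈ C * (0# - W)
    combined = solve 4 (λ C q W r → C :* C :* q :+ #2 :* (C :* :- #1) :* W :+ (:- #1 :* :- #1) :* r
      :+ C :* C :* (#0 :- q) :+ (C :* W :- r) := C :* (#0 :- W)) refl C q W r

  -- Let w = Mv and let q(x) ≤ C|x|² for all x. Then 0 ≤ q(Cv - w) = C² q(v) - 2C|w|² + q(w) ≤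
  -- -C|w|², so w vanishes.
  psd-kernel : ∀ {M : Matrix n} → Symmetric M → (∀ x → 0# ≤ quad M x) →
               ∀ {v} → quad M v ≤ 0# → Zero (apply M v)
  psd-kernel {M = M} M-sym psd {v} qv≤0 =
    let w = apply M v
        C , 0<C , bound = quad-bound M
    in normSq-zero w (psd-kernel-scalar 0<C qv≤0 (bound w)
      (≤-resp (trans (quad-combine M-sym C v (- 1#) w) (+-congʳ (+-congˡ (*-congˡ (form-comm M-sym v w)))))
        (psd (combine C v (- 1#) w))))

  shift : Carrier → Matrix n → Matrix n
  shift t M i j = t * δ i j - M i j

  shift-sym : ∀ {M : Matrix n} → Symmetric M → ∀ t → Symmetric (shift t M)
  shift-sym M-sym t i j = +-cong (*-congˡ (δ-sym i j)) (-‿cong (M-sym i j))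

  apply-shift : ∀ (M : Matrix n) t v i → apply (shift t M) v i ≈ t * v i - apply M v i
  apply-shift M t v i = begin
    dot (shift t M i) v
      ≈⟨ dot-cong (λ j → solve 2 (λ x y → x :- y := x :+ (:- #1) :* y) refl (t * δ i j) (M i j)) (λ _ → refl) ⟩
    dot (combine t (δ i) (- 1#) (M i)) v
      ≈⟨ dot-combineˡ v t (δ i) (- 1#) (M i) ⟩
    t * dot (δ i) v + - 1# * apply M v i
      ≈⟨ +-congʳ (*-congˡ (dot-δ i v)) ⟩
    t * v i + - 1# * apply M v i
      ≈⟨ solve 2 (λ x y → x :+ (:- #1) :* y := x :- y) refl (t * v i) (apply M v i) ⟩
    t * v i - apply M v i ∎

  quad-shift : ∀ (M : Matrix n) t v → quad (shift t M) v ≈ t * normSq v - quad M v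
  quad-shift M t v = begin
    dot v (apply (shift t M) v)
      ≈⟨ dot-cong (λ _ → refl) (λ i → trans (apply-shift M t v i)
           (solve 3 (λ t x y → t :* x :- y := t :* x :+ (:- #1) :* y) refl t (v i) (apply M v i))) ⟩
    dot v (combine t v (- 1#) (apply M v))
      ≈⟨ dot-combineʳ v t v (- 1#) (apply M v) ⟩
    t * normSq v + - 1# * quad M v
      ≈⟨ solve 2 (λ x y → x :+ (:- #1) :* y := x :- y) refl (t * normSq v) (quad M v) ⟩
    t * normSq v - quad M v ∎

  schurComplement : Carrier → Matrix (suc n) → Matrix n
  schurComplement a⁻¹ M i j = M (suc i) (suc j) - a⁻¹ * (M zero (suc i) * M zero (suc j))

  schurComplement-sym : ∀ {M : Matrix (suc n)} → Symmetric M → ∀ a⁻¹ → Symmetric (schurComplement a⁻¹ M)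
  schurComplement-sym M-sym a⁻¹ i j = +-cong (M-sym (suc i) (suc j)) (-‿cong (*-congˡ (*-comm _ _)))

  quad-schurComplement : ∀ (M : Matrix (suc n)) a⁻¹ y → let b = tail (M zero) in
    quad (schurComplement a⁻¹ M) y ≈ quad (λ i j → M (suc i) (suc j)) y - a⁻¹ * (dot b y * dot b y)
  quad-schurComplement M a⁻¹ y = begin
    dot y (λ i → dot (schurComplement a⁻¹ M i) y)
      ≈⟨ dot-cong (λ _ → refl) row ⟩
    dot y (combine 1# (apply C y) (- (a⁻¹ * dot b y)) b)
      ≈⟨ dot-combineʳ y 1# (apply C y) (- (a⁻¹ * dot b y)) b ⟩
    1# * quad C y + - (a⁻¹ * dot b y) * dot y b
      ≈⟨ +-congˡ (*-congˡ (dot-comm y b)) ⟩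
    1# * quad C y + - (a⁻¹ * dot b y) * dot b y
      ≈⟨ solve 3 (λ q a β → #1 :* q :+ :- (a :* β) :* β := q :- a :* (β :* β)) refl (quad C y) a⁻¹ (dot b y) ⟩
    quad C y - a⁻¹ * (dot b y * dot b y) ∎
    where
    b = tail (M zero)
    C = λ i j → M (suc i) (suc j)

    row : ∀ i → dot (schurComplement a⁻¹ M i) y ≈ 1# * apply C y i + - (a⁻¹ * dot b y) * b i
    row i = begin
      dot (schurComplement a⁻¹ M i) y
        ≈⟨ dot-cong (λ j → solve 4 (λ c a p q → c :- a :* (p :* q) := #1 :* c :+ :- (a :* p) :* q)
                      refl (C i j) a⁻¹ (b i) (b j)) (λ _ → refl) ⟩
      dot (combine 1# (C i) (- (a⁻¹ * b i)) b) y
        ≈⟨ dot-combineˡ y 1# (C i) (- (a⁻¹ * b i)) b ⟩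
      1# * apply C y i + - (a⁻¹ * b i) * dot b y
        ≈⟨ +-congˡ (solve 3 (λ a p β → :- (a :* p) :* β := :- (a :* β) :* p) refl a⁻¹ (b i) (dot b y)) ⟩
      1# * apply C y i + - (a⁻¹ * dot b y) * b i ∎

  -- One step of symmetric elimination: completing the square in the first coordinate leaves the
  -- Schur complement as the form in the remaining ones.
  complete-square : ∀ {M : Matrix (suc n)} → Symmetric M → ∀ {a⁻¹} → M zero zero * a⁻¹ ≈ 1# → ∀ x →
    let w = head x + a⁻¹ * dot (tail (M zero)) (tail x) in
    quad M x ≈ M zero zero * (w * w) + quad (schurComplement a⁻¹ M) (tail x)
  complete-square {M = M} M-sym {a⁻¹} aa⁻¹≈1 x = begin
    quad M x
      ≈⟨ trans (dot-∷ x (apply M x)) (+-cong (*-congˡ (dot-∷ (M zero) x)) (dot-cong (λ _ → refl) λ i → dot-∷ (M (suc i)) x)) ⟩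
    x₀ * (a * x₀ + β) + dot y (λ i → M (suc i) zero * x₀ + apply C y i)
      ≈⟨ +-congˡ (dot-cong (λ _ → refl) λ i → +-cong (trans (*-comm _ _) (*-congˡ (M-sym (suc i) zero))) (sym (*-identityˡ _))) ⟩
    x₀ * (a * x₀ + β) + dot y (combine x₀ b 1# (apply C y))
      ≈⟨ +-congˡ (dot-combineʳ y x₀ b 1# (apply C y)) ⟩
    x₀ * (a * x₀ + β) + (x₀ * dot y b + 1# * quad C y)
      ≈⟨ +-congˡ (+-congʳ (*-congˡ (dot-comm y b))) ⟩
    x₀ * (a * x₀ + β) + (x₀ * β + 1# * quad C y)
      -- The solver cannot use a·a⁻¹ = 1, so factors 1 are displayed at the places where the next
      -- step writes a·a⁻¹.
      ≈⟨ solve 5 (λ a x β q z → x :* (a :* x :+ β) :+ (x :* β :+ #1 :* q)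
           := a :* (x :* x) :+ #2 :* #1 :* (x :* β) :+ #1 :* (z :* (β :* β)) :+ (q :- z :* (β :* β))) refl a x₀ β (quad C y) a⁻¹ ⟩
    a * (x₀ * x₀) + (1# + 1#) * 1# * (x₀ * β) + 1# * (a⁻¹ * (β * β)) + (quad C y - a⁻¹ * (β * β))
      ≈⟨ +-cong (+-cong (+-congˡ (*-congʳ (*-congˡ aa⁻¹≈1))) (*-congʳ aa⁻¹≈1)) (quad-schurComplement M a⁻¹ y) ⟨
    a * (x₀ * x₀) + (1# + 1#) * (a * a⁻¹) * (x₀ * β) + (a * a⁻¹) * (a⁻¹ * (β * β)) + quad S y
      ≈⟨ +-congʳ (solve 4 (λ a z x β → a :* (x :* x) :+ #2 :* (a :* z) :* (x :* β) :+ (a :* z) :* (z :* (β :* β))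
           := a :* ((x :+ z :* β) :* (x :+ z :* β))) refl a a⁻¹ x₀ β) ⟩
    a * ((x₀ + a⁻¹ * β) * (x₀ + a⁻¹ * β)) + quad S y ∎
    where
    a = M zero zero
    b = tail (M zero)
    C = λ i j → M (suc i) (suc j)
    S = schurComplement a⁻¹ M
    x₀ = head x
    y = tail x
    β = dot b y

  -- Definiteness with a uniform constant: this is the margin that `λmax-indefinite` sets against
  -- vectors that almost attain the supremum.
  Definite : Matrix n → Set _
  Definite M = ∃[ C ] (0# < C × ∀ x → normSq x ≤ C * quad M x)

  Isotropic : Carrier → Matrix n → Set _
  Isotropic ε M = ∃[ v ] (¬ Zero v × quad M v ≤ ε * normSq v)

  -- Since x = w - zβ, x² ≤ 2w² + 2z²β² ≤ 2w² + 2z²BX. Now w² = z·aw² and X ≤ Cq, which gives 2z as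
  -- the coefficient of aw² and (2z²B + 1)C as that of q; the constant is their sum.
  definite-scalar : ∀ {a z x β X B C q} → 0# < a → 0# < z → a * z ≈ 1# → 0# < B → 0# < C → 0# ≤ X →
    β * β ≤ B * X → X ≤ C * q → let w = x + z * β in
    x * x + X ≤ (z + z + ((1# + 1#) * (z * z * B) + 1#) * C) * (a * (w * w) + q)
  definite-scalar {a} {z} {x} {β} {X} {B} {C} {q} 0<a 0<z az≈1 0<B 0<C 0≤X ββ≤BX X≤Cq =
    0≤⇒≤ nonneg (trans identity (trans (+-congˡ (trans (*-congˡ 1-az≈0) (zeroʳ _))) (+-identityʳ _)))
    where
    w = x + z * β
    k = (1# + 1#) * (z * z * B) + 1#
    rhs = (z + z + k * C) * (a * (w * w) + q) - (x * x + X)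
    e = z * q + z * q + k * (C * (a * (w * w))) + k * (C * q - X) + (z * z + z * z) * (B * X - β * β)
          + (w + z * β) * (w + z * β)

    0≤q : 0# ≤ q
    0≤q = nonneg-cancelˡ 0<C (≤-trans 0≤X X≤Cq)

    0≤k : 0# ≤ k
    0≤k = <⇒≤ (+-pos (*-pos (+-pos 0<1 0<1) (*-pos (*-pos 0<z 0<z) 0<B)) 0<1)

    nonneg : 0# ≤ e
    nonneg = +-nonneg (+-nonneg (+-nonneg (+-nonneg
      (+-nonneg (*-nonneg (<⇒≤ 0<z) 0≤q) (*-nonneg (<⇒≤ 0<z) 0≤q))
      (*-nonneg 0≤k (*-nonneg (<⇒≤ 0<C) (*-nonneg (<⇒≤ 0<a) (square-nonneg w)))))
      (*-nonneg 0≤k (≤⇒0≤- X≤Cq)))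
      (*-nonneg (+-nonneg (square-nonneg z) (square-nonneg z)) (≤⇒0≤- ββ≤BX)))
      (square-nonneg (w + z * β))

    1-az≈0 : 1# - a * z ≈ 0#
    1-az≈0 = trans (+-congˡ (-‿cong az≈1)) (-‿inverseʳ 1#)

    -- A polynomial identity in independent a and z; the surplus multiple of 1 - az is killed by
    -- `az≈1`.
    identity : e ≈ rhs + (w * w + w * w) * (1# - a * z)
    identity = solve 8 (λ a z x β X B C q →
      let w = x :+ z :* β ; k = #2 :* (z :* z :* B) :+ #1 in
      z :* q :+ z :* q :+ k :* (C :* (a :* (w :* w))) :+ k :* (C :* q :- X) :+ (z :* z :+ z :* z) :* (B :* X :- β :* β)
          :+ (w :+ z :* β) :* (w :+ z :* β)
      := (z :+ z :+ k :* C) :* (a :* (w :* w) :+ q) :- (x :* x :+ X) :+ (w :* w :+ w :* w) :* (#1 :- a :* z))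
      refl a z x β X B C q

  isotropic-scalar : ∀ {a s q ε Y} → 0# ≤ ε → q ≤ ε * Y →
    a * ((- s + s) * (- s + s)) + q ≤ ε * (- s * - s + Y)
  isotropic-scalar {a} {s} {q} {ε} {Y} 0≤ε q≤εY = 0≤⇒≤ (+-nonneg (*-nonneg 0≤ε (square-nonneg s)) (≤⇒0≤- q≤εY))
    (solve 5 (λ a s q ε Y → ε :* (s :* s) :+ (ε :* Y :- q)
       := ε :* (:- s :* :- s :+ Y) :- (a :* ((:- s :+ s) :* (:- s :+ s)) :+ q)) refl a s q ε Y)

  -- Gaussian elimination in continuation-passing style: deciding the sign of a pivot
  -- is possible up to ε > 0 for every R, and exactly (ε = 0) when R = ⊥.
  definite-or-isotropic : ∀ {r} {R : Set r} {ε} → 0# ≤ ε → (∀ a → (0# < a → R) → (a ≤ ε → R) → R) →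
    ∀ {n} {M : Matrix n} → Symmetric M → (Definite M → R) → (Isotropic ε M → R) → R
  definite-or-isotropic 0≤ε sign {zero} M-sym definite isotropic =
    definite (1# , 0<1 , λ x → ≤-reflexive (trans (dot-[] x x)
      (sym (trans (*-congˡ (dot-[] x _)) (zeroʳ 1#)))))
  definite-or-isotropic {R = R} {ε} 0≤ε sign {suc n} {M} M-sym definite isotropic =
    sign a pivot λ a≤ε → isotropic (δ zero , δ-nonzero zero ,
      ≤-respˡ (sym (quad-δ M zero)) (≤-respʳ (sym (trans (*-congˡ (normSq-δ {suc n} zero)) (*-identityʳ ε))) a≤ε))
    where
    a = M zero zero
    b = tail (M zero)

    pivot : 0# < a → R
    pivot 0<a =
      let z , 0<z , az≈1 = reciprocal 0<a
          B , 0<B , bound = dot-bound b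
      in definite-or-isotropic 0≤ε sign (schurComplement-sym {M = M} M-sym z)
        (λ (C , 0<C , S-definite) → definite
          ( z + z + ((1# + 1#) * (z * z * B) + 1#) * C
          , +-pos (+-pos 0<z 0<z) (*-pos (+-pos (*-pos (+-pos 0<1 0<1) (*-pos (*-pos 0<z 0<z) 0<B)) 0<1) 0<C)
          , λ x → ≤-respˡ (sym (normSq-∷ x)) (≤-respʳ (*-congˡ (sym (complete-square {M = M} M-sym az≈1 x)))
              (definite-scalar 0<a 0<z az≈1 0<B 0<C (normSq-nonneg (tail x)) (bound (tail x)) (S-definite (tail x))))))
        -- This first coordinate makes the completed square vanish, so the form at `v` equals the
        -- Schur complement at `y`.
        (λ (y , y≉0 , qy≤) → let v = (- (z * dot b y)) ∷ y in isotropic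
          ( v
          , (λ v≈0 → y≉0 (v≈0 ∘ suc))
          , ≤-respˡ (sym (complete-square {M = M} M-sym az≈1 v)) (≤-respʳ (*-congˡ (sym (normSq-∷ v)))
              (isotropic-scalar 0≤ε qy≤))))

-- The supremum of the Rayleigh quotient as an eigenvalue.

module RayleighPrinciple {c ℓ₁ ℓ₂} (ℝ : RealNumbers c ℓ₁ ℓ₂) where
  open RealNumbers ℝ using (orderedField; archimedean; complete)
  open OrderedFieldProperties orderedField
  open QuadraticForms orderedField hiding (Matrix)
  open Spectrum ℝ using (Matrix; IsEigenvalue)

  module Principle {n} {M : Matrix (suc n)} (M-sym : Symmetric M) where

    IsUpperBound : Carrier → Set _
    IsUpperBound t = ∀ x → quad M x ≤ t * normSq x

    Attained : Carrier → Set _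
    Attained s = ∃[ v ] (¬ Zero v × s * normSq v ≤ quad M v)

    upperBound-mono : ∀ {s t} → s ≤ t → IsUpperBound s → IsUpperBound t
    upperBound-mono s≤t bound x = ≤-trans (bound x) (≤-*-nonneg (normSq-nonneg x) s≤t)

    attained-mono : ∀ {s t} → s ≤ t → Attained t → Attained s
    attained-mono s≤t (v , v≉0 , tN≤q) = v , v≉0 , ≤-trans (≤-*-nonneg (normSq-nonneg v) s≤t) tN≤q

    attained≤upperBound : ∀ {s t} → Attained s → IsUpperBound t → s ≤ t
    attained≤upperBound {s} {t} (v , v≉0 , sN≤q) bound t<s =
      v≉0 (normSq-zero v λ 0<N → ≤-trans sN≤q (bound v)
        (0<⇒< (*-pos (<⇒0<- t<s) 0<N) (solve 3 (λ s t N → (s :- t) :* N := s :* N :- t :* N) refl s t (normSq v))))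

    -- Elimination on tI - M with tolerance t - s. A vector with t|v|² - q(v) ≤ (t - s)|v|²
    -- satisfies s|v|² ≤ q(v).
    upperBound-or-attained : ∀ {s t} → s < t → IsUpperBound t ⊎ Attained s
    upperBound-or-attained {s} {t} s<t = definite-or-isotropic (<⇒≤ 0<t-s) sign (shift-sym M-sym t)
      (λ (C , 0<C , definite) → inj₁ λ x →
        0≤⇒≤ (nonneg-cancelˡ 0<C (≤-trans (normSq-nonneg x) (definite x))) (quad-shift M t x))
      (λ (v , v≉0 , qv≤) → inj₂ (v , v≉0 , 0≤⇒≤ (≤⇒0≤- (≤-respˡ (quad-shift M t v) qv≤))
        (solve 4 (λ s t N q → (t :- s) :* N :- (t :* N :- q) := q :- s :* N) refl s t (normSq v) (quad M v))))
      where
      0<t-s = <⇒0<- s<t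
      sign : ∀ a → (0# < a → IsUpperBound t ⊎ Attained s) → (a ≤ t - s → IsUpperBound t ⊎ Attained s) →
             IsUpperBound t ⊎ Attained s
      sign a pos nonpos with <-cotrans 0<t-s a
      ... | inj₁ 0<a   = pos 0<a
      ... | inj₂ a<t-s = nonpos (<⇒≤ a<t-s)

    -- Climbs from an attained value in steps of η, with `k` the number of steps left. Each round
    -- compares s + η with s + 2η: either s + 2η is an upper bound lying 2η above the attained s, or
    -- s + η is attained and the climb goes on.
    search : ∀ {η} → 0# < η → ∀ k {s} → Attained s → IsUpperBound (s + fromℕ k * η) →
             ∃[ t ] (IsUpperBound t × Attained (t - (η + η)))
    search {η} 0<η zero {s} attained bound = s + 0# * η , bound , attained-mono
      (0≤⇒≤ (<⇒≤ (+-pos 0<η 0<η)) (solve 2 (λ s η → η :+ η := s :- (s :+ #0 :* η :- (η :+ η))) refl s η)) attained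
    search {η} 0<η (suc k) {s} attained bound = [ found , continue ]′ (upperBound-or-attained s+η<s+2η)
      where
      s+η<s+2η : s + η < s + (η + η)
      s+η<s+2η = 0<⇒< 0<η (solve 2 (λ s η → η := s :+ (η :+ η) :- (s :+ η)) refl s η)

      found : IsUpperBound (s + (η + η)) → ∃[ t ] (IsUpperBound t × Attained (t - (η + η)))
      found bound′ = s + (η + η) , bound′ , attained-mono
        (≤-reflexive (solve 2 (λ s η → s :+ (η :+ η) :- (η :+ η) := s) refl s η)) attained

      continue : Attained (s + η) → ∃[ t ] (IsUpperBound t × Attained (t - (η + η)))
      continue attained′ = search 0<η k attained′ (upperBound-mono
        (≤-reflexive (solve 3 (λ s η k → s :+ (#1 :+ k) :* η := s :+ η :+ k :* η) refl s η (fromℕ k))) bound)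

    approximate : ∀ {η} → 0# < η → ∃[ t ] (IsUpperBound t × Attained (t - (η + η)))
    approximate {η} 0<η =
      let C , _ , bound = quad-bound M
          -- The climb starts at the Rayleigh quotient of the first basis vector; the Archimedean
          -- property supplies enough steps of size η to pass the bound `C`.
          s = M zero zero
          z , 0<z , ηz≈1 = reciprocal 0<η
          k , [C-s]z<k = archimedean ((C - s) * z)
      in search 0<η k {s}
        ( δ zero , δ-nonzero zero
        , ≤-reflexive (trans (*-congˡ (normSq-δ {suc n} zero)) (trans (*-identityʳ s) (sym (quad-δ M zero)))))
        (upperBound-mono (0≤⇒≤ (*-nonneg (≤⇒0≤- (<⇒≤ [C-s]z<k)) (<⇒≤ 0<η)) (begin
            (fromℕ k - (C - s) * z) * η
              ≈⟨ solve 5 (λ k C s z η → (k :- (C :- s) :* z) :* η := k :* η :- (C :- s) :* (η :* z)) refl (fromℕ k) C s z η ⟩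
            fromℕ k * η - (C - s) * (η * z)
              ≈⟨ +-congˡ (-‿cong (*-congˡ ηz≈1)) ⟩
            fromℕ k * η - (C - s) * 1#
              ≈⟨ solve 3 (λ e C s → e :- (C :- s) :* #1 := s :+ e :- C) refl (fromℕ k * η) C s ⟩
            s + fromℕ k * η - C ∎)) bound)

    width : ℕ → Carrier
    width k = proj₁ (reciprocal (fromℕ-pos k))

    width-pos : ∀ k → 0# < width k
    width-pos k = proj₁ (proj₂ (reciprocal (fromℕ-pos k)))

    width-inverse : ∀ k → fromℕ (suc k) * width k ≈ 1#
    width-inverse k = proj₂ (proj₂ (reciprocal (fromℕ-pos k)))

    width-small : ∀ {ε} → 0# < ε → ∃[ N ] (∀ k → N ℕ.≤ k → width k + width k < ε)
    width-small {ε} 0<ε =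
      let z , 0<z , εz≈1 = reciprocal 0<ε
          N , 2z<N = archimedean (z + z)
      in N , λ k N≤k → let η = width k ; j = fromℕ (suc k) in
        0<⇒< (*-pos (*-pos 0<ε (width-pos k)) (<⇒0<- (<-≤-trans 2z<N (fromℕ-mono-≤ (ℕₚ.m≤n⇒m≤1+n N≤k))))) (begin
          ε * η * (j - (z + z))
            ≈⟨ solve 4 (λ ε η j z → ε :* η :* (j :- (z :+ z)) := ε :* (j :* η) :- (ε :* z) :* (η :+ η)) refl ε η j z ⟩
          ε * (j * η) - (ε * z) * (η + η)
            ≈⟨ +-cong (*-congˡ (width-inverse k)) (-‿cong (*-congʳ εz≈1)) ⟩
          ε * 1# - 1# * (η + η)
            ≈⟨ solve 2 (λ ε η → ε :* #1 :- #1 :* η := ε :- η) refl ε (η + η) ⟩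
          ε - (η + η) ∎)

    approximant : ℕ → Carrier
    approximant k = proj₁ (approximate (width-pos k))

    approximant-upperBound : ∀ k → IsUpperBound (approximant k)
    approximant-upperBound k = proj₁ (proj₂ (approximate (width-pos k)))

    approximant-attained : ∀ k → Attained (approximant k - (width k + width k))
    approximant-attained k = proj₂ (proj₂ (approximate (width-pos k)))

    -- The i-th approximant minus 2/(i + 1) is attained and the j-th is an upper bound, so their
    -- difference is at most 2/(i + 1) for every `j`.
    approximant-cauchy : RealNumbers.IsCauchy ℝ approximant
    approximant-cauchy ε 0<ε = let N , small = width-small 0<ε in N , λ i j N≤i _ →
      ≤-<-trans
        (0≤⇒≤ (≤⇒0≤- (attained≤upperBound (approximant-attained i) (approximant-upperBound j)))
          (solve 3 (λ u v w → v :- (u :- w) := w :- (u :- v)) refl (approximant i) (approximant j) (width i + width i)))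
        (small i N≤i)

    opaque
      λmax : Carrier
      λmax = proj₁ (complete approximant approximant-cauchy)

      approximant-converges : RealNumbers.ConvergesTo ℝ approximant λmax
      approximant-converges = proj₂ (complete approximant approximant-cauchy)

    λmax-upperBound : IsUpperBound λmax
    λmax-upperBound x λN<q =
      let N = normSq x
          g = quad M x - λmax * N
          0<g = <⇒0<- λN<q
          -- Dividing by N + 1 instead of N avoids having to know that `x` is nonzero.
          z , 0<z , [N+1]z≈1 = reciprocal (+-pos-nonneg 0<1 (normSq-nonneg x))
          k , close = approximant-converges (g * z) (*-pos 0<g 0<z)
          u = approximant k
      in 0≤⇒≤ (+-nonneg (≤⇒0≤- (approximant-upperBound k x))
                (*-nonneg (≤⇒0≤- (<⇒≤ (proj₁ (close k ℕₚ.≤-refl)))) (normSq-nonneg x)))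
           (begin
             u * N - quad M x + (g * z - (u - λmax)) * N
               ≈⟨ solve 5 (λ u N q z l → u :* N :- q :+ ((q :- l :* N) :* z :- (u :- l)) :* N
                    := #0 :- (q :- l :* N) :* z :+ (q :- l :* N) :* ((#1 :+ N) :* z :- #1)) refl u N (quad M x) z λmax ⟩
             0# - g * z + g * ((1# + N) * z - 1#)
               ≈⟨ +-congˡ (*-congˡ (trans (+-congʳ [N+1]z≈1) (-‿inverseʳ 1#))) ⟩
             0# - g * z + g * 0#
               ≈⟨ solve 2 (λ g z → #0 :- g :* z :+ g :* #0 := #0 :- g :* z) refl g z ⟩
             0# - g * z ∎)
           (*-pos 0<g 0<z)

    λmax-attained : ∀ {ε} → 0# < ε → Attained (λmax - (ε + ε))
    λmax-attained {ε} 0<ε =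
      let N₁ , small = width-small 0<ε
          N₂ , close = approximant-converges ε 0<ε
          i = N₁ ℕ.⊔ N₂
      in attained-mono
        (0≤⇒≤ (+-nonneg (≤⇒0≤- (<⇒≤ (small i (ℕₚ.m≤m⊔n N₁ N₂)))) (≤⇒0≤- (<⇒≤ (proj₂ (close i (ℕₚ.m≤n⊔m N₁ N₂))))))
          (solve 4 (λ ε w l u → ε :- w :+ (ε :- (l :- u)) := u :- w :- (l :- (ε :+ ε))) refl
            ε (width i + width i) λmax (approximant i)))
        (approximant-attained i)

    λmax-indefinite : ¬ Definite (shift λmax M)
    λmax-indefinite (C , 0<C , definite) =
      -- With z = 1/(3C), a vector attaining `λmax` up to 2z would satisfy |v|² ≤ 2Cz|v|² =
      -- (2/3)|v|².
      let z , 0<z , 3Cz≈1 = reciprocal (+-pos (+-pos 0<C 0<C) 0<C)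
          v , v≉0 , attained = λmax-attained 0<z
          N = normSq v
      in v≉0 (normSq-zero v λ 0<N →
        0≤⇒≤ (+-nonneg (≤⇒0≤- (≤-respʳ (*-congˡ (quad-shift M λmax v)) (definite v)))
               (*-nonneg (<⇒≤ 0<C) (≤⇒0≤- attained)))
          (begin
            C * (λmax * N - quad M v) - N + C * (quad M v - (λmax - (z + z)) * N)
              ≈⟨ solve 5 (λ C l N q z → C :* (l :* N :- q) :- N :+ C :* (q :- (l :- (z :+ z)) :* N)
                   := #0 :- C :* z :* N :+ ((C :+ C :+ C) :* z :- #1) :* N) refl C λmax N (quad M v) z ⟩
            0# - C * z * N + ((C + C + C) * z - 1#) * N
              ≈⟨ +-congˡ (*-congʳ (trans (+-congʳ 3Cz≈1) (-‿inverseʳ 1#))) ⟩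
            0# - C * z * N + 0# * N
              ≈⟨ solve 2 (λ a N → #0 :- a :+ #0 :* N := #0 :- a) refl (C * z * N) N ⟩
            0# - C * z * N ∎)
          (*-pos (*-pos 0<C 0<z) 0<N))

    λmax-isEigenvalue : ¬ ¬ IsEigenvalue M λmax
    λmax-isEigenvalue ¬eigenvalue =
      -- With goal `⊥`, the continuation for a positive pivot is itself a proof that the pivot is
      -- `≤ 0#`, so the sign test is free.
      definite-or-isotropic (≤-reflexive refl) (λ _ pos nonpos → nonpos pos) (shift-sym M-sym λmax) λmax-indefinite
        λ (v , v≉0 , qv≤0) → ¬eigenvalue (v , v≉0 , λ i →
          let kernel : apply (shift λmax M) v i ≈ 0#
              kernel = psd-kernel (shift-sym M-sym λmax) (λ x → ≤-resp (sym (quad-shift M λmax x)) (≤⇒0≤- (λmax-upperBound x)))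
                        (≤-respʳ (zeroˡ (normSq v)) qv≤0) i
          in begin
            sum (λ j → M i j * v j)
              ≈⟨ dot≈sum (M i) v ⟨
            apply M v i
              ≈⟨ solve 2 (λ a b → b := a :- (a :- b)) refl (λmax * v i) (apply M v i) ⟩
            λmax * v i - (λmax * v i - apply M v i)
              ≈⟨ +-congˡ (-‿cong (trans (sym (apply-shift M λmax v i)) kernel)) ⟩
            λmax * v i - 0#
              ≈⟨ solve 1 (λ a → a :- #0 := a) refl (λmax * v i) ⟩
            λmax * v i ∎)

  -- The conclusion is a negation, so it follows from the double-negated eigenvalue property of
  -- `λmax`.
  rayleigh : ∀ {n} {M : Matrix (suc n)} → Symmetric M → ∀ {μ} → (∀ ν → IsEigenvalue M ν → ν ≤ μ) →
             ∀ x → quad M x ≤ μ * normSq x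
  rayleigh M-sym {μ} largest x μN<q = λmax-isEigenvalue λ eigenvalue →
    upperBound-mono (largest λmax eigenvalue) λmax-upperBound x μN<q
    where open Principle M-sym

-- The Laplacian form and its test vectors.

module LaplacianForm {c ℓ₁ ℓ₂} (ℝ : RealNumbers c ℓ₁ ℓ₂) where
  open RealNumbers ℝ using (orderedField)
  open OrderedFieldProperties orderedField
  open QuadraticForms orderedField
  open Spectrum ℝ using (degreeMatrix; adjacencyMatrix; laplacian)

  fromℕ-sum : ∀ {n} (t : Fin n → ℕ) → fromℕ (ℕSum.sum t) ≈ sum (fromℕ ∘ t)
  fromℕ-sum {zero}  t = refl
  fromℕ-sum {suc n} t = trans (fromℕ-+ (t zero) _) (+-congˡ (fromℕ-sum (t ∘ suc)))

  ones : ∀ {n} → Vector Carrier n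
  ones _ = 1#

  dot-ones : ∀ {n} (u : Vector Carrier n) → dot u ones ≈ sum u
  dot-ones u = trans (dot≈sum u ones) (sum-cong λ i → *-identityʳ (u i))

  sum-ones : ∀ n → sum {n} ones ≈ fromℕ n
  sum-ones n = sum-replicate n

  module _ {n} (G : Graph n) where

    private
      A = adjacencyMatrix G
      L = laplacian G

      d : Fin n → Carrier
      d i = fromℕ (degree G i)

    degreeMatrix≈ : ∀ i j → degreeMatrix G i j ≈ d i * δ i j
    degreeMatrix≈ i j with i ≟ j
    ... | yes _ = sym (*-identityʳ _)
    ... | no _  = sym (zeroʳ _)

    adjacency-sym : Symmetric A
    adjacency-sym i j = reflexive (≡.cong (if_then 1# else 0#) (adj-sym G i j))

    laplacian-sym : Symmetric L
    laplacian-sym i j = +-cong (degree-sym i j) (-‿cong (adjacency-sym i j))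
      where
      degree-sym : Symmetric (degreeMatrix G)
      degree-sym i j with i ≟ j | j ≟ i
      ... | yes ≡.refl | yes _   = refl
      ... | no _       | no _    = refl
      ... | yes i≡j    | no j≢i  = contradiction (≡.sym i≡j) j≢i
      ... | no i≢j     | yes j≡i = contradiction (≡.sym j≡i) i≢j

    degree≈sum : ∀ i → d i ≈ sum (A i)
    degree≈sum i = trans (fromℕ-sum λ j → if adj G i j then 1 else 0) (sum-cong λ j → entry (adj G i j))
      where
      entry : ∀ b → fromℕ (if b then 1 else 0) ≈ (if b then 1# else 0#)
      entry true  = +-identityʳ 1#
      entry false = refl

    adjacency-idem : ∀ i j → A i j * A i j ≈ A i j
    adjacency-idem i j with adj G i j
    ... | true  = *-identityˡ 1#
    ... | false = zeroˡ 0#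

    adjacency-nonneg : ∀ i j → 0# ≤ A i j
    adjacency-nonneg i j with adj G i j
    ... | true  = <⇒≤ 0<1
    ... | false = ≤-reflexive refl

    laplacian≈ : ∀ i j → laplacian G i j ≈ d i * δ i j - A i j
    laplacian≈ i j = +-congʳ (degreeMatrix≈ i j)

    apply-laplacian : ∀ v i → apply L v i ≈ d i * v i - dot (A i) v
    apply-laplacian v i = begin
      dot (L i) v
        ≈⟨ dot-cong (λ j → trans (laplacian≈ i j)
             (solve 2 (λ x y → x :- y := x :+ :- #1 :* y) refl (d i * δ i j) (A i j))) (λ _ → refl) ⟩
      dot (combine (d i) (δ i) (- 1#) (A i)) v
        ≈⟨ dot-combineˡ v (d i) (δ i) (- 1#) (A i) ⟩
      d i * dot (δ i) v + - 1# * dot (A i) v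
        ≈⟨ +-congʳ (*-congˡ (dot-δ i v)) ⟩
      d i * v i + - 1# * dot (A i) v
        ≈⟨ solve 2 (λ x y → x :+ :- #1 :* y := x :- y) refl (d i * v i) (dot (A i) v) ⟩
      d i * v i - dot (A i) v ∎

    laplacian-ones : ∀ i → apply L ones i ≈ 0#
    laplacian-ones i = begin
      apply L ones i             ≈⟨ apply-laplacian ones i ⟩
      d i * 1# - dot (A i) ones  ≈⟨ +-cong (*-identityʳ (d i)) (-‿cong (trans (dot-ones (A i)) (sym (degree≈sum i)))) ⟩
      d i - d i                  ≈⟨ -‿inverseʳ (d i) ⟩
      0#                         ∎

    quad-laplacian : ∀ v → quad L v ≈ sum λ i → sum λ j → A i j * (v i * v i - v i * v j)
    quad-laplacian v = trans (dot≈sum v (apply L v)) (sum-cong λ i → begin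
      v i * apply L v i
        ≈⟨ *-congˡ (trans (apply-laplacian v i) (+-cong (*-congʳ (trans (degree≈sum i) (sym (dot-ones (A i))))) refl)) ⟩
      v i * (dot (A i) ones * v i - dot (A i) v)
        ≈⟨ solve 3 (λ v o w → v :* (o :* v :- w) := v :* v :* o :+ :- v :* w) refl (v i) (dot (A i) ones) (dot (A i) v) ⟩
      v i * v i * dot (A i) ones + - v i * dot (A i) v
        ≈⟨ dot-combineʳ (A i) (v i * v i) ones (- v i) v ⟨
      dot (A i) (combine (v i * v i) ones (- v i) v)
        ≈⟨ dot≈sum (A i) _ ⟩
      sum (λ j → A i j * (v i * v i * 1# + - v i * v j))
        ≈⟨ sum-cong (λ j → *-congˡ (solve 2 (λ a b → a :* a :* #1 :+ :- a :* b := a :* a :- a :* b) refl (v i) (v j))) ⟩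
      sum (λ j → A i j * (v i * v i - v i * v j)) ∎)

    -- Adding the double sum to its transpose produces squares. Ordered pairs meet every edge twice,
    -- hence the factor two on the left.
    double-quad-laplacian : ∀ v → quad L v + quad L v ≈ sum λ i → sum λ j → A i j * ((v i - v j) * (v i - v j))
    double-quad-laplacian v = begin
      quad L v + quad L v
        ≈⟨ +-cong (quad-laplacian v) (trans (quad-laplacian v) (∑-comm f)) ⟩
      sum (λ i → sum λ j → f i j) + sum (λ i → sum λ j → f j i)
        ≈⟨ ∑-distrib-+ (λ i → sum λ j → f i j) (λ i → sum λ j → f j i) ⟨
      sum (λ i → sum (λ j → f i j) + sum (λ j → f j i))
        ≈⟨ sum-cong (λ i → ∑-distrib-+ (λ j → f i j) (λ j → f j i)) ⟨
      sum (λ i → sum λ j → f i j + f j i)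
        ≈⟨ sum-cong (λ i → sum-cong λ j → trans (+-congˡ (*-congʳ (adjacency-sym j i)))
             (solve 3 (λ a x y → a :* (x :* x :- x :* y) :+ a :* (y :* y :- y :* x) := a :* ((x :- y) :* (x :- y)))
               refl (A i j) (v i) (v j))) ⟩
      sum (λ i → sum λ j → A i j * ((v i - v j) * (v i - v j))) ∎
      where
      f : Fin n → Fin n → Carrier
      f i j = A i j * (v i * v i - v i * v j)

    laplacian-psd : ∀ v → 0# ≤ quad L v
    laplacian-psd v = nonneg-cancelˡ (+-pos 0<1 0<1) (≤-resp
      (trans (sym (double-quad-laplacian v)) (solve 1 (λ q → q :+ q := #2 :* q) refl (quad L v)))
      (sum-nonneg λ i → sum-nonneg λ j → *-nonneg (adjacency-nonneg i j) (square-nonneg (v i - v j))))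

    adjacency-diag : ∀ i → A i i ≈ 0#
    adjacency-diag i = reflexive (≡.cong (if_then 1# else 0#) (adj-irrefl G i))

    laplacian-diag : ∀ i → L i i ≈ d i
    laplacian-diag i = trans (laplacian≈ i i)
      (trans (+-cong (trans (*-congˡ (δ-diag i)) (*-identityʳ (d i))) (-‿cong (adjacency-diag i)))
        (solve 1 (λ d → d :- #0 := d) refl (d i)))

    laplacian-off : ∀ {i j} → i ≢ j → L i j ≈ - A i j
    laplacian-off {i} {j} i≢j = trans (laplacian≈ i j)
      (trans (+-congʳ (trans (*-congˡ (δ-off i≢j)) (zeroʳ (d i)))) (+-identityˡ (- A i j)))

    -- With x = L e_u, symmetry gives |x|² = (Lx)_u, where x is d at u and -1 at each of the d
    -- neighbours.
    normSq-column : ∀ u → normSq (apply L (δ u)) ≈ d u * d u + d u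
    normSq-column u = begin
      form L x (δ u)                    ≈⟨ form-comm laplacian-sym x (δ u) ⟩
      dot (δ u) (apply L x)             ≈⟨ dot-δ u (apply L x) ⟩
      apply L x u                       ≈⟨ apply-laplacian x u ⟩
      d u * x u - dot (A u) x
        ≈⟨ +-cong (*-congˡ (trans (apply-δ L u u) (laplacian-diag u))) (-‿cong neighbours) ⟩
      d u * d u - - d u                 ≈⟨ solve 1 (λ d → d :* d :- :- d := d :* d :+ d) refl (d u) ⟩
      d u * d u + d u                   ∎
      where
      x = apply L (δ u)

      entry : ∀ j → A u j * x j ≈ - A u j
      entry j with u ≟ j
      ... | yes ≡.refl = trans (*-congʳ (adjacency-diag u)) (trans (zeroˡ (x u))
                           (sym (trans (-‿cong (adjacency-diag u)) -0#≈0#)))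
      ... | no u≢j = begin
        A u j * x j        ≈⟨ *-congˡ (trans (apply-δ L j u) (trans (laplacian-off (u≢j ∘ ≡.sym)) (-‿cong (adjacency-sym j u)))) ⟩
        A u j * - A u j    ≈⟨ solve 1 (λ a → a :* :- a := :- (a :* a)) refl (A u j) ⟩
        - (A u j * A u j)  ≈⟨ -‿cong (adjacency-idem u j) ⟩
        - A u j            ∎

      neighbours : dot (A u) x ≈ - d u
      neighbours = begin
        dot (A u) x                     ≈⟨ dot≈sum (A u) x ⟩
        sum (λ j → A u j * x j)         ≈⟨ sum-cong (λ j → trans (entry j) (solve 1 (λ a → :- a := :- #1 :* a) refl (A u j))) ⟩
        sum (λ j → - 1# * A u j)        ≈⟨ *-distribˡ-sum (- 1#) (A u) ⟨
        - 1# * sum (A u)                ≈⟨ *-congˡ (degree≈sum u) ⟨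
        - 1# * d u                      ≈⟨ solve 1 (λ a → :- #1 :* a := :- a) refl (d u) ⟩
        - d u                           ∎

    IsUpperBound : Carrier → Set _
    IsUpperBound μ = ∀ v → quad L v ≤ μ * normSq v

    upperBound-nonneg : ∀ {μ} → Fin n → IsUpperBound μ → 0# ≤ μ
    upperBound-nonneg {μ} u bound = ≤-trans (laplacian-psd (δ u))
      (≤-respʳ (trans (*-congˡ (normSq-δ u)) (*-identityʳ μ)) (bound (δ u)))

    -- Since x = L e_u satisfies |x|² = d² + d, where d is the degree of u, expanding
    -- 0 ≤ q(x - (d + 1) e_u) gives (d + 1) |x|² ≤ q(x).
    degree<upperBound : ∀ {μ} → IsUpperBound μ → ∀ u → 0 ℕ.< degree G u → fromℕ (suc (degree G u)) ≤ μ
    degree<upperBound {μ} bound u 0<deg μ<1+d =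
      ≤-trans lower (bound x) (0<⇒< (*-pos (<⇒0<- μ<1+d) 0<N)
        (solve 3 (λ D N μ → (D :- μ) :* N := D :* N :- μ :* N) refl D (normSq x) μ))
      where
      x = apply L (δ u)
      D = 1# + d u

      0<d : 0# < d u
      0<d = <-≤-trans (fromℕ-pos 0) (fromℕ-mono-≤ 0<deg)

      0<N : 0# < normSq x
      0<N = <-respʳ (sym (normSq-column u)) (+-pos (*-pos 0<d 0<d) 0<d)

      lower : D * normSq x ≤ quad L x
      lower = 0≤⇒≤ (laplacian-psd (combine 1# x (- D) (δ u))) (begin
        quad L (combine 1# x (- D) (δ u))
          ≈⟨ quad-combine laplacian-sym 1# x (- D) (δ u) ⟩
        1# * 1# * quad L x + (1# + 1#) * (1# * - D) * normSq x + - D * - D * quad L (δ u)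
          ≈⟨ +-cong (+-congˡ (*-congˡ (normSq-column u))) (*-congˡ (trans (quad-δ L u) (laplacian-diag u))) ⟩
        1# * 1# * quad L x + (1# + 1#) * (1# * - D) * (d u * d u + d u) + - D * - D * d u
          ≈⟨ solve 2 (λ q d → let D = #1 :+ d in
               #1 :* #1 :* q :+ #2 :* (#1 :* :- D) :* (d :* d :+ d) :+ :- D :* :- D :* d
               := q :- D :* (d :* d :+ d)) refl (quad L x) (d u) ⟩
        quad L x - D * (d u * d u + d u)
          ≈⟨ +-congˡ (-‿cong (*-congˡ (normSq-column u))) ⟨
        quad L x - D * normSq x ∎)

    -- Written as a sum of basis vectors so that pairing with it is an exchange of sums; it is the
    -- characteristic vector of the image once `p` is injective.
    indicator : ∀ {σ} → (Fin σ → Fin n) → Vector Carrier n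
    indicator p i = sum λ k → δ (p k) i

    dot-indicator : ∀ {σ} (p : Fin σ → Fin n) f → dot (indicator p) f ≈ sum (f ∘ p)
    dot-indicator p f = begin
      dot (indicator p) f                        ≈⟨ dot≈sum (indicator p) f ⟩
      sum (λ i → sum (λ k → δ (p k) i) * f i)    ≈⟨ sum-cong (λ i → *-distribʳ-sum (f i) (λ k → δ (p k) i)) ⟩
      sum (λ i → sum λ k → δ (p k) i * f i)      ≈⟨ ∑-comm (λ i k → δ (p k) i * f i) ⟩
      sum (λ k → sum λ i → δ (p k) i * f i)      ≈⟨ sum-cong (λ k → trans (sym (dot≈sum (δ (p k)) f)) (dot-δ (p k) f)) ⟩
      sum (f ∘ p)                                ∎

    module _ {σ} {p : Fin σ → Fin n} (p-injective : ∀ {k l} → p k ≡ p l → k ≡ l) where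

      private
        s = indicator p

      indicator-∘ : ∀ k → s (p k) ≈ 1#
      indicator-∘ k = trans
        (FiniteSums.sum-single +-commutativeMonoid (λ l → δ (p l) (p k)) k (λ l k≢l → δ-off (k≢l ∘ ≡.sym ∘ p-injective)))
        (δ-diag (p k))

      normSq-indicator : normSq s ≈ fromℕ σ
      normSq-indicator = trans (dot-indicator p s) (trans (sum-cong indicator-∘) (sum-ones σ))

      internalDegrees : ℕ
      internalDegrees = ℕSum.sum λ k → ℕSum.sum λ l → if adj G (p k) (p l) then 1 else 0

      -- The form at the indicator counts the edges leaving the set: of the rσ edge ends in it,
      -- `internalDegrees` belong to edges that stay inside, two for each.
      quad-indicator : ∀ {r} → (∀ i → degree G i ≡ r) → quad L s + fromℕ internalDegrees ≈ fromℕ (r ℕ.* σ)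
      quad-indicator {r} regular = begin
        quad L s + fromℕ internalDegrees
          ≈⟨ +-cong (dot-indicator p (apply L s))
               (trans (fromℕ-sum (λ k → ℕSum.sum λ l → if adj G (p k) (p l) then 1 else 0))
                 (sum-cong λ k → trans (fromℕ-sum (λ l → if adj G (p k) (p l) then 1 else 0)) (sum-cong λ l → entry (adj G (p k) (p l))))) ⟩
        sum (λ k → apply L s (p k)) + sum (λ k → sum λ l → A (p k) (p l))
          ≈⟨ ∑-distrib-+ (λ k → apply L s (p k)) (λ k → sum λ l → A (p k) (p l)) ⟨
        sum (λ k → apply L s (p k) + sum λ l → A (p k) (p l))
          ≈⟨ sum-cong row ⟩
        sum {σ} (λ k → fromℕ r * 1#)
          ≈⟨ *-distribˡ-sum (fromℕ r) (ones {σ}) ⟨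
        fromℕ r * sum (ones {σ})
          ≈⟨ *-congˡ (sum-ones σ) ⟩
        fromℕ r * fromℕ σ
          ≈⟨ fromℕ-* r σ ⟨
        fromℕ (r ℕ.* σ) ∎
        where
        entry : ∀ b → fromℕ (if b then 1 else 0) ≈ (if b then 1# else 0#)
        entry true  = +-identityʳ 1#
        entry false = refl

        row : ∀ k → apply L s (p k) + sum (λ l → A (p k) (p l)) ≈ fromℕ r * 1#
        row k = begin
          apply L s (p k) + sum (A (p k) ∘ p)
            ≈⟨ +-cong (apply-laplacian s (p k)) (sym (trans (dot-comm (A (p k)) s) (dot-indicator p (A (p k))))) ⟩
          d (p k) * s (p k) - dot (A (p k)) s + dot (A (p k)) s
            ≈⟨ solve 2 (λ a b → a :- b :+ b := a) refl (d (p k) * s (p k)) (dot (A (p k)) s) ⟩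
          d (p k) * s (p k)
            ≈⟨ *-cong (fromℕ-cong (regular (p k))) (indicator-∘ k) ⟩
          fromℕ r * 1# ∎

      -- The test vector n·1_S - |S|·1 is orthogonal to the constants.
      subset-upperBound : ∀ {μ r e ν c} → IsUpperBound μ → (∀ i → degree G i ≡ r) →
        c ℕ.+ internalDegrees ℕ.≤ r ℕ.* σ → suc ν ℕ.+ n ℕ.* (σ ℕ.* σ) ≡ n ℕ.* n ℕ.* σ →
        e ℕ.* suc ν ℕ.≤ n ℕ.* n ℕ.* c → fromℕ e ≤ μ
      subset-upperBound {μ} {r} {e} {ν} {c} bound regular c≤ ν+nσσ≡nnσ eν≤nnc μ<e =
        lower (≤-<-trans (bound x) (<-respˡ (*-congˡ (sym normSq-x))
          (0<⇒< (*-pos (<⇒0<- μ<e) (fromℕ-pos ν))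
            (trans (solve 3 (λ e m ν → (e :- m) :* ν := e :* ν :- m :* ν) refl (fromℕ e) μ (fromℕ (suc ν)))
              (+-congʳ (sym (fromℕ-* e (suc ν))))))))
        where
        N = fromℕ n
        S = fromℕ σ
        x = combine N s (- S) ones

        -- `suc ν` is nσ(n - σ), fixed by an equation without subtraction; the successor records
        -- that the norm is positive.
        normSq-x : normSq x ≈ fromℕ (suc ν)
        normSq-x = begin
          normSq x
            ≈⟨ normSq-combine N s (- S) ones ⟩
          N * N * normSq s + (1# + 1#) * (N * - S) * dot s ones + - S * - S * normSq (ones {n})
            ≈⟨ +-cong (+-cong (*-congˡ normSq-indicator) (*-congˡ (trans (dot-indicator p ones) (sum-ones σ))))
                 (*-congˡ (trans (dot-ones (ones {n})) (sum-ones n))) ⟩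
          N * N * S + (1# + 1#) * (N * - S) * S + - S * - S * N
            ≈⟨ solve 2 (λ N S → N :* N :* S :+ #2 :* (N :* :- S) :* S :+ :- S :* :- S :* N
                 := N :* N :* S :- N :* (S :* S)) refl N S ⟩
          N * N * S - N * (S * S)
            ≈⟨ +-cong (trans (fromℕ-* (n ℕ.* n) σ) (*-congʳ (fromℕ-* n n)))
                 (-‿cong (trans (fromℕ-* n (σ ℕ.* σ)) (*-congˡ (fromℕ-* σ σ)))) ⟨
          fromℕ (n ℕ.* n ℕ.* σ) - fromℕ (n ℕ.* (σ ℕ.* σ))
            ≈⟨ +-congʳ (trans (fromℕ-cong (≡.sym ν+nσσ≡nnσ)) (fromℕ-+ (suc ν) (n ℕ.* (σ ℕ.* σ)))) ⟩
          fromℕ (suc ν) + fromℕ (n ℕ.* (σ ℕ.* σ)) - fromℕ (n ℕ.* (σ ℕ.* σ))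
            ≈⟨ solve 2 (λ a b → a :+ b :- b := a) refl (fromℕ (suc ν)) (fromℕ (n ℕ.* (σ ℕ.* σ))) ⟩
          fromℕ (suc ν) ∎

        zero-row : ∀ v → dot v (apply L ones) ≈ 0#
        zero-row v = trans (dot≈sum v (apply L ones))
          (trans (sum-cong λ i → trans (*-congˡ (laplacian-ones i)) (zeroʳ (v i))) (sum-replicate-zero n))

        quad-x : quad L x ≈ N * N * quad L s
        quad-x = begin
          quad L x
            ≈⟨ quad-combine laplacian-sym N s (- S) ones ⟩
          N * N * quad L s + (1# + 1#) * (N * - S) * form L s ones + - S * - S * quad L ones
            ≈⟨ +-cong (+-congˡ (*-congˡ (zero-row s))) (*-congˡ (zero-row ones)) ⟩
          N * N * quad L s + (1# + 1#) * (N * - S) * 0# + - S * - S * 0#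
            ≈⟨ solve 3 (λ N S q → N :* N :* q :+ #2 :* (N :* :- S) :* #0 :+ :- S :* :- S :* #0 := N :* N :* q)
                 refl N S (quad L s) ⟩
          N * N * quad L s ∎

        c≤quad : fromℕ c ≤ quad L s
        c≤quad = 0≤⇒≤ (≤⇒0≤- (fromℕ-mono-≤ c≤)) (begin
          fromℕ (r ℕ.* σ) - fromℕ (c ℕ.+ internalDegrees)
            ≈⟨ +-cong (sym (quad-indicator regular)) (-‿cong (fromℕ-+ c internalDegrees)) ⟩
          quad L s + fromℕ internalDegrees - (fromℕ c + fromℕ internalDegrees)
            ≈⟨ solve 3 (λ q i c → q :+ i :- (c :+ i) := q :- c) refl (quad L s) (fromℕ internalDegrees) (fromℕ c) ⟩
          quad L s - fromℕ c ∎)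

        lower : fromℕ (e ℕ.* suc ν) ≤ quad L x
        lower = ≤-trans (fromℕ-mono-≤ eν≤nnc) (0≤⇒≤ (*-nonneg (square-nonneg N) (≤⇒0≤- c≤quad)) (begin
          N * N * (quad L s - fromℕ c)
            ≈⟨ solve 3 (λ N q c → N :* (q :- c) := N :* q :- N :* c) refl (N * N) (quad L s) (fromℕ c) ⟩
          N * N * quad L s - N * N * fromℕ c
            ≈⟨ +-cong quad-x (-‿cong (trans (fromℕ-* (n ℕ.* n) c) (*-congʳ (fromℕ-* n n)))) ⟨
          quad L x - fromℕ (n ℕ.* n ℕ.* c) ∎))

-- Degree counting and short cycles in small regular graphs.

module GraphCounting where
  open ≡ using (refl; sym; trans; cong; cong₂)
  open import Data.Nat.Base using (_+_; _*_; _≤_; _<_)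
  open import Data.Nat.Properties using (≤-trans; ≤-refl; ≤-reflexive; +-mono-≤)
  open ℕSum using (sum; ∑-distrib-+; ∑-comm; sum-cong-≗; sum-replicate-zero)
  open FiniteSums ℕₚ.+-0-commutativeMonoid using (sum-select; sum-split)

  sum-mono-≤ : ∀ {n} {f g : Fin n → ℕ} → (∀ i → f i ≤ g i) → sum f ≤ sum g
  sum-mono-≤ {zero}  f≤g = z≤n
  sum-mono-≤ {suc n} f≤g = +-mono-≤ (f≤g zero) (sum-mono-≤ (f≤g ∘ suc))

  sum-const : ∀ n {c} → sum {n} (λ _ → c) ≡ n * c
  sum-const zero    = refl
  sum-const (suc n) = cong (_ +_) (sum-const n)

  sum-suc : ∀ {n} (f : Fin n → ℕ) → sum (suc ∘ f) ≡ n + sum f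
  sum-suc {n} f = trans (∑-distrib-+ (λ _ → 1) f) (cong (_+ sum f) (trans (sum-const n) (ℕₚ.*-identityʳ n)))

  sum-saturated : ∀ {n} {f : Fin n → ℕ} {c} → (∀ i → f i ≤ c) → n * c ≤ sum f → ∀ i → f i ≡ c
  sum-saturated {suc n} {f} {c} f≤c nc≤sum = λ where
      zero    → ℕₚ.≤-antisym (f≤c zero) (ℕₚ.+-cancelʳ-≤ (n * c) c (f zero) (≤-trans nc≤sum (ℕₚ.+-monoʳ-≤ (f zero) tail≤)))
      (suc i) → sum-saturated (f≤c ∘ suc)
        (ℕₚ.+-cancelˡ-≤ c (n * c) _ (≤-trans nc≤sum (ℕₚ.+-monoˡ-≤ _ (f≤c zero)))) i
    where
    tail≤ : sum (f ∘ suc) ≤ n * c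
    tail≤ = ≤-trans (sum-mono-≤ (f≤c ∘ suc)) (≤-reflexive (sum-const n))

  sum-positive : ∀ {n} {f : Fin n → ℕ} → 0 < sum f → ∃[ i ] 0 < f i
  sum-positive {suc n} {f} 0<sum with f zero in eq
  ... | suc _ = zero , ≤-trans (s≤s z≤n) (≤-reflexive (sym eq))
  ... | zero  = let i , 0<fi = sum-positive 0<sum in suc i , 0<fi

  sum-deficient : ∀ {n} {f : Fin n → ℕ} → sum f < n → ∃[ i ] f i ≡ 0
  sum-deficient {suc n} {f} sum<n with f zero in eq
  ... | zero  = zero , eq
  ... | suc k = let i , fi≡0 = sum-deficient (≤-trans (s≤s (ℕₚ.m≤n+m _ k)) (ℕ.s≤s⁻¹ sum<n)) in suc i , fi≡0

  indic : Bool → ℕ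
  indic b = if b then 1 else 0

  indic≤1 : ∀ b → indic b ≤ 1
  indic≤1 true  = ≤-refl
  indic≤1 false = z≤n

  indic-true : ∀ {b} → 0 < indic b → b ≡ true
  indic-true {true} _ = refl

  sum-indic≤1 : ∀ {n} (b : Fin n → Bool) → (∀ i j → b i ≡ true → b j ≡ true → i ≡ j) → sum (indic ∘ b) ≤ 1
  sum-indic≤1 {zero}  b unique = z≤n
  sum-indic≤1 {suc n} b unique with b zero in eq
  ... | false = sum-indic≤1 (b ∘ suc) λ i j bi bj → suc-injective (unique (suc i) (suc j) bi bj)
  ... | true  = s≤s (ℕₚ.≮⇒≥ λ 0<sum → let i , 0<bi = sum-positive 0<sum in
    case unique zero (suc i) eq (indic-true 0<bi) of λ ())

  δℕ : ∀ {n} → Fin n → Fin n → ℕ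
  δℕ i j = indic ⌊ i ≟ j ⌋

  sum-δℕ : ∀ {n} (i : Fin n) → sum (δℕ i) ≡ 1
  sum-δℕ i = sum-select i (λ _ → 1)

  module _ {n} (G : Graph n) where

    codegree : Fin n → Fin n → ℕ
    codegree i j = sum λ t → indic (adj G i t ∧ adj G j t)

    TriangleFree : Set
    TriangleFree = ∀ {i j k} → adj G i j ≡ true → adj G i k ≡ true → adj G j k ≡ true → ⊥

    -- `i`, `k` and `j`, `l` are opposite corners. Only they need to be assumed distinct, since
    -- adjacency separates the other pairs.
    SquareFree : Set
    SquareFree = ∀ {i j k l} → i ≢ k → j ≢ l →
      adj G i j ≡ true → adj G k j ≡ true → adj G i l ≡ true → adj G k l ≡ true → ⊥

  indic-∧ : ∀ a b → indic (a ∧ b) ≡ indic a * indic b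
  indic-∧ true  b = sym (ℕₚ.+-identityʳ (indic b))
  indic-∧ false b = refl

  -- There are 9 walks of length two from u. Three return to u, none ends at a neighbour without a
  -- triangle, and at most one ends at each of the 4 remaining vertices without a square: 9 ≤ 3 + 4
  -- fails.
  cubic-8-has-short-cycle : ∀ (G : Graph 8) → (∀ i → degree G i ≡ 3) → TriangleFree G → ¬ SquareFree G
  cubic-8-has-short-cycle G cubic noTriangle noSquare = case 12≤10 of λ { (s≤s (s≤s (s≤s (s≤s (s≤s (s≤s (s≤s (s≤s (s≤s (s≤s ())))))))))) }
    where
    u : Fin 8
    u = zero

    -- One bound for the three kinds of vertex: 3 + 0 at u, 0 + 1 at a neighbour, at most 1 + 0
    -- elsewhere. Summed over w it reads 9 + 3 ≤ 8 + 2.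
    pointwise : ∀ w → codegree G u w + indic (adj G u w) ≤ 1 + (δℕ u w + δℕ u w)
    pointwise w with u ≟ w
    ... | yes refl = +-mono-≤
      (≤-trans (sum-mono-≤ λ t → ≤-reflexive (cong indic (∧-self (adj G u t)))) (≤-reflexive (cubic u)))
      (≤-reflexive (cong indic (adj-irrefl G u)))
      where
      ∧-self : ∀ b → b ∧ b ≡ b
      ∧-self true  = refl
      ∧-self false = refl
    ... | no u≢w with adj G u w in uw
    ...   | true  = +-mono-≤ {x = codegree G u w} {y = 0}
      (≤-trans (sum-mono-≤ λ t → absent t) (≤-reflexive (sum-replicate-zero 8))) ≤-refl
      where
      absent : ∀ t → indic (adj G u t ∧ adj G w t) ≤ 0
      absent t with adj G u t in ut | adj G w t in wt
      ... | true  | true  = ⊥-elim (noTriangle uw ut wt)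
      ... | true  | false = z≤n
      ... | false | _     = z≤n
    ...   | false = +-mono-≤ {v = 0} (sum-indic≤1 _ λ i j bi bj → unique i j (∧-true bi) (∧-true bj)) z≤n
      where
      ∧-true : ∀ {a b} → a ∧ b ≡ true → a ≡ true × b ≡ true
      ∧-true {true} {true} _ = refl , refl

      unique : ∀ i j → adj G u i ≡ true × adj G w i ≡ true → adj G u j ≡ true × adj G w j ≡ true → i ≡ j
      unique i j (ui , wi) (uj , wj) with i ≟ j
      ... | yes i≡j = i≡j
      ... | no i≢j  = ⊥-elim (noSquare u≢w i≢j ui wi uj wj)

    sum-codegree : sum (codegree G u) ≡ 9
    sum-codegree = begin
      sum (λ w → sum λ t → indic (adj G u t ∧ adj G w t))
        ≡⟨ ∑-comm (λ w t → indic (adj G u t ∧ adj G w t)) ⟩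
      sum (λ t → sum λ w → indic (adj G u t ∧ adj G w t))
        ≡⟨ sum-cong-≗ row ⟩
      sum (λ t → indic (adj G u t) * 3)
        ≡⟨ *-distribʳ-sum 3 (λ t → indic (adj G u t)) ⟨
      degree G u * 3
        ≡⟨ cong (_* 3) (cubic u) ⟩
      9 ∎
      where
      open ≡.≡-Reasoning
      open import Algebra.Properties.Semiring.Sum ℕₚ.+-*-semiring using (*-distribʳ-sum; *-distribˡ-sum)

      row : ∀ t → sum (λ w → indic (adj G u t ∧ adj G w t)) ≡ indic (adj G u t) * 3
      row t = begin
        sum (λ w → indic (adj G u t ∧ adj G w t))
          ≡⟨ sum-cong-≗ (λ w → trans (cong (λ b → indic (adj G u t ∧ b)) (adj-sym G w t)) (indic-∧ (adj G u t) (adj G t w))) ⟩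
        sum (λ w → indic (adj G u t) * indic (adj G t w))
          ≡⟨ *-distribˡ-sum (indic (adj G u t)) (λ w → indic (adj G t w)) ⟨
        indic (adj G u t) * degree G t
          ≡⟨ cong (indic (adj G u t) *_) (cubic t) ⟩
        indic (adj G u t) * 3 ∎

    12≤10 : 12 ≤ 10
    12≤10 = begin
      9 + 3
        ≡⟨ cong₂ _+_ (sym sum-codegree) (sym (cubic u)) ⟩
      sum (codegree G u) + degree G u
        ≡⟨ ∑-distrib-+ (codegree G u) (λ w → indic (adj G u w)) ⟨
      sum (λ w → codegree G u w + indic (adj G u w))
        ≤⟨ sum-mono-≤ pointwise ⟩
      10 ∎
      where open ℕₚ.≤-Reasoning

  -- Take an edge uv and a vertex w adjacent to neither end, which exists because 4 + 4 < 9. Without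
  -- triangles, w has at least three common neighbours with each of u and v, and these are distinct
  -- because u and v share none: 6 ≤ deg w = 4 is absurd.
  quartic-9-has-triangle : ∀ (G : Graph 9) → (∀ i → degree G i ≡ 4) → ¬ TriangleFree G
  quartic-9-has-triangle G quartic noTriangle =
    let u = zero
        v , 0<uv = sum-positive {f = λ j → indic (adj G u j)} (≤-trans (s≤s z≤n) (≤-reflexive (sym (quartic u))))
        uv = indic-true 0<uv
        w , uw+vw≡0 = sum-deficient {f = λ j → indic (adj G u j) + indic (adj G v j)}
          (s≤s (≤-reflexive (trans (∑-distrib-+ (λ j → indic (adj G u j)) (λ j → indic (adj G v j)))
            (cong₂ _+_ (quartic u) (quartic v)))))
        uw = indic-false (ℕₚ.m+n≡0⇒m≡0 (indic (adj G u w)) uw+vw≡0)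
        vw = indic-false (ℕₚ.m+n≡0⇒n≡0 (indic (adj G u w)) uw+vw≡0)
        u≢w : u ≢ w
        u≢w u≡w = true≢false (trans (sym uv) (trans (adj-sym G u v) (trans (cong (adj G v) u≡w) vw)))
        v≢w : v ≢ w
        v≢w v≡w = true≢false (trans (sym uv) (trans (cong (adj G u) v≡w) uw))
    in case ≤-trans (+-mono-≤ (codegree≥3 u≢w uw) (codegree≥3 v≢w vw)) (codegree-sum≤ uv w) of
         λ { (s≤s (s≤s (s≤s (s≤s ())))) }
    where
    indic-false : ∀ {b} → indic b ≡ 0 → b ≡ false
    indic-false {false} _ = refl

    true≢false : true ≢ false
    true≢false ()

    -- The two neighbourhoods, of total size 8, lie among the 7 vertices other than x and y; the δ
    -- terms account for these two.
    codegree≥1 : ∀ {x y} → x ≢ y → adj G x y ≡ false → 1 ≤ codegree G x y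
    codegree≥1 {x} {y} x≢y xy = ℕₚ.+-cancelˡ-≤ 9 _ _ (begin
      4 + 4 + (1 + 1)
        ≡⟨ cong₂ _+_ (cong₂ _+_ (quartic x) (quartic y)) (cong₂ _+_ (sum-δℕ x) (sum-δℕ y)) ⟨
      degree G x + degree G y + (sum (δℕ x) + sum (δℕ y))
        ≡⟨ cong₂ _+_ (∑-distrib-+ (λ t → indic (adj G x t)) (λ t → indic (adj G y t))) (∑-distrib-+ (δℕ x) (δℕ y)) ⟨
      sum (λ t → indic (adj G x t) + indic (adj G y t)) + sum (λ t → δℕ x t + δℕ y t)
        ≡⟨ ∑-distrib-+ (λ t → indic (adj G x t) + indic (adj G y t)) (λ t → δℕ x t + δℕ y t) ⟨
      sum (λ t → indic (adj G x t) + indic (adj G y t) + (δℕ x t + δℕ y t))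
        ≤⟨ sum-mono-≤ pointwise ⟩
      sum (λ t → 1 + indic (adj G x t ∧ adj G y t))
        ≡⟨ sum-suc (λ t → indic (adj G x t ∧ adj G y t)) ⟩
      9 + codegree G x y ∎)
      where
      open ℕₚ.≤-Reasoning

      pointwise : ∀ t → indic (adj G x t) + indic (adj G y t) + (δℕ x t + δℕ y t) ≤ 1 + indic (adj G x t ∧ adj G y t)
      pointwise t with x ≟ t | y ≟ t
      ... | yes refl | yes y≡t  = contradiction (sym y≡t) x≢y
      ... | yes refl | no _     rewrite adj-irrefl G x | adj-sym G y x | xy = ≤-refl
      ... | no _     | yes refl rewrite adj-irrefl G y | xy = ≤-refl
      ... | no _     | no _ with adj G x t | adj G y t
      ...   | true  | true  = ≤-refl
      ...   | true  | false = ≤-refl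
      ...   | false | true  = ≤-refl
      ...   | false | false = z≤n

    -- A common neighbour z has, without triangles, a neighbourhood disjoint from those of x and y.
    -- So 12 = 4 + 4 + 4 counts only the common neighbours of x and y twice, among 9 vertices.
    codegree≥3 : ∀ {x y} → x ≢ y → adj G x y ≡ false → 3 ≤ codegree G x y
    codegree≥3 {x} {y} x≢y xy with sum-positive (codegree≥1 x≢y xy)
    ... | z , 0<xz∧yz = ℕₚ.+-cancelˡ-≤ 9 _ _ (begin
      4 + 4 + 4
        ≡⟨ cong₂ _+_ (cong₂ _+_ (quartic z) (quartic x)) (quartic y) ⟨
      degree G z + degree G x + degree G y
        ≡⟨ cong (_+ degree G y) (∑-distrib-+ (λ t → indic (adj G z t)) (λ t → indic (adj G x t))) ⟨
      sum (λ t → indic (adj G z t) + indic (adj G x t)) + degree G y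
        ≡⟨ ∑-distrib-+ (λ t → indic (adj G z t) + indic (adj G x t)) (λ t → indic (adj G y t)) ⟨
      sum (λ t → indic (adj G z t) + indic (adj G x t) + indic (adj G y t))
        ≤⟨ sum-mono-≤ (pointwise (∧-true (indic-true 0<xz∧yz))) ⟩
      sum (λ t → 1 + indic (adj G x t ∧ adj G y t))
        ≡⟨ sum-suc (λ t → indic (adj G x t ∧ adj G y t)) ⟩
      9 + codegree G x y ∎)
      where
      open ℕₚ.≤-Reasoning

      ∧-true : ∀ {a b} → a ∧ b ≡ true → a ≡ true × b ≡ true
      ∧-true {true} {true} _ = refl , refl

      pointwise : adj G x z ≡ true × adj G y z ≡ true → ∀ t →
        indic (adj G z t) + indic (adj G x t) + indic (adj G y t) ≤ 1 + indic (adj G x t ∧ adj G y t)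
      pointwise (xz , yz) t with adj G z t in zt | adj G x t in xt | adj G y t in yt
      ... | true  | true  | _     = ⊥-elim (noTriangle xz xt zt)
      ... | true  | false | true  = ⊥-elim (noTriangle yz yt zt)
      ... | true  | false | false = ≤-refl
      ... | false | true  | true  = ≤-refl
      ... | false | true  | false = ≤-refl
      ... | false | false | true  = ≤-refl
      ... | false | false | false = z≤n

    codegree-sum≤ : ∀ {u v} → adj G u v ≡ true → ∀ w → codegree G u w + codegree G v w ≤ 4
    codegree-sum≤ {u} {v} uv w = begin
      codegree G u w + codegree G v w
        ≡⟨ ∑-distrib-+ (λ t → indic (adj G u t ∧ adj G w t)) (λ t → indic (adj G v t ∧ adj G w t)) ⟨
      sum (λ t → indic (adj G u t ∧ adj G w t) + indic (adj G v t ∧ adj G w t))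
        ≤⟨ sum-mono-≤ pointwise ⟩
      degree G w
        ≡⟨ quartic w ⟩
      4 ∎
      where
      open ℕₚ.≤-Reasoning

      pointwise : ∀ t → indic (adj G u t ∧ adj G w t) + indic (adj G v t ∧ adj G w t) ≤ indic (adj G w t)
      pointwise t with adj G u t in ut | adj G v t in vt
      ... | true  | true  = ⊥-elim (noTriangle uv ut vt)
      ... | true  | false = ≤-reflexive (ℕₚ.+-identityʳ _)
      ... | false | true  = ≤-refl
      ... | false | false = z≤n

  complement : ∀ {n} → Graph n → Graph n
  complement {n} G = record
    { adj        = λ i j → adj (K n) i j ∧ not (adj G i j)
    ; adj-sym    = λ i j → cong₂ _∧_ (adj-sym (K n) i j) (cong not (adj-sym G i j))
    ; adj-irrefl = λ i → cong (_∧ not (adj G i i)) (adj-irrefl (K n) i)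
    }

  complement-adj : ∀ {n} (G : Graph n) {i j} → adj (complement G) i j ≡ true → i ≢ j × adj G i j ≡ false
  complement-adj G {i} {j} e with i ≟ j | adj G i j
  ... | no i≢j | false = i≢j , refl

  degree-complement : ∀ {n} (G : Graph n) i → degree G i + degree (complement G) i + 1 ≡ n
  degree-complement {n} G i = begin
    degree G i + degree (complement G) i + 1
      ≡⟨ cong₂ _+_ (∑-distrib-+ g g′) (sum-δℕ i) ⟨
    sum (λ j → g j + g′ j) + sum (δℕ i)
      ≡⟨ ∑-distrib-+ (λ j → g j + g′ j) (δℕ i) ⟨
    sum (λ j → g j + g′ j + δℕ i j)
      ≡⟨ sum-cong-≗ pointwise ⟩
    sum {n} (λ _ → 1)
      ≡⟨ trans (sum-const n) (ℕₚ.*-identityʳ n) ⟩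
    n ∎
    where
    open ≡.≡-Reasoning
    g g′ : Fin n → ℕ
    g j = indic (adj G i j)
    g′ j = indic (adj (complement G) i j)

    pointwise : ∀ j → g j + g′ j + δℕ i j ≡ 1
    pointwise j with i ≟ j
    ... | yes refl rewrite adj-irrefl G i = refl
    ... | no _ with adj G i j
    ...   | true  = refl
    ...   | false = refl

  complement-regular : ∀ {n r} (G : Graph n) → (∀ i → degree G i ≡ r) →
    ∀ {s} → r + s + 1 ≡ n → ∀ i → degree (complement G) i ≡ s
  complement-regular {n} {r} G regular {s} r+s+1≡n i = ℕₚ.+-cancelˡ-≡ r _ s (ℕₚ.+-cancelʳ-≡ 1 _ _ (begin
    r + degree (complement G) i + 1            ≡⟨ cong (λ d → d + degree (complement G) i + 1) (regular i) ⟨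
    degree G i + degree (complement G) i + 1   ≡⟨ degree-complement G i ⟩
    n                                          ≡⟨ r+s+1≡n ⟨
    r + s + 1                                  ∎))
    where open ≡.≡-Reasoning

  -- Handshake lemma: `up` sees each edge from its smaller end, the transpose of `up` from its
  -- larger one.
  sum-degree : ∀ {n} (G : Graph n) → sum (degree G) ≡ numEdges G + numEdges G
  sum-degree {n} G = begin
    sum (λ i → sum λ j → indic (adj G i j))
      ≡⟨ sum-cong-≗ (λ i → trans (sum-cong-≗ (pointwise i)) (∑-distrib-+ (up i) (λ j → up j i))) ⟩
    sum (λ i → sum (up i) + sum λ j → up j i)
      ≡⟨ ∑-distrib-+ (λ i → sum (up i)) (λ i → sum λ j → up j i) ⟩
    numEdges G + sum (λ i → sum λ j → up j i)
      ≡⟨ cong (numEdges G +_) (∑-comm (λ i j → up j i)) ⟩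
    numEdges G + numEdges G ∎
    where
    open ≡.≡-Reasoning
    up : Fin n → Fin n → ℕ
    up i j = indic (⌊ i <? j ⌋ ∧ adj G i j)

    pointwise : ∀ i j → indic (adj G i j) ≡ up i j + up j i
    pointwise i j with i <? j | j <? i | <-cmp i j
    ... | yes _   | yes j<i | tri< _ _ j≮i  = contradiction j<i j≮i
    ... | yes i<j | _       | tri≈ i≮j _ _  = contradiction i<j i≮j
    ... | yes i<j | _       | tri> i≮j _ _  = contradiction i<j i≮j
    ... | yes _   | no _    | tri< _ _ _    = sym (ℕₚ.+-identityʳ _)
    ... | no _    | yes _   | tri> _ _ _    = cong indic (adj-sym G i j)
    ... | no _    | yes j<i | tri< _ _ j≮i  = contradiction j<i j≮i
    ... | no _    | yes j<i | tri≈ _ _ j≮i  = contradiction j<i j≮i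
    ... | no i≮j  | no _    | tri< i<j _ _  = contradiction i<j i≮j
    ... | no _    | no j≮i  | tri> _ _ j<i  = contradiction j<i j≮i
    ... | no _    | no _    | tri≈ _ refl _ = cong indic (adj-irrefl G i)

  module _ {a b} (G : Graph a) (H : Graph b) where
    adj-∪-ˡˡ : ∀ i j → adj (G ∪ H) (i ↑ˡ b) (j ↑ˡ b) ≡ adj G i j
    adj-∪-ˡˡ i j rewrite splitAt-↑ˡ a i b | splitAt-↑ˡ a j b = refl

    adj-∪-ʳʳ : ∀ i j → adj (G ∪ H) (a ↑ʳ i) (a ↑ʳ j) ≡ adj H i j
    adj-∪-ʳʳ i j rewrite splitAt-↑ʳ a b i | splitAt-↑ʳ a b j = refl

    adj-∪-ˡʳ : ∀ i j → adj (G ∪ H) (i ↑ˡ b) (a ↑ʳ j) ≡ false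
    adj-∪-ˡʳ i j rewrite splitAt-↑ˡ a i b | splitAt-↑ʳ a b j = refl

    adj-∪-ʳˡ : ∀ i j → adj (G ∪ H) (a ↑ʳ i) (j ↑ˡ b) ≡ false
    adj-∪-ʳˡ i j rewrite splitAt-↑ʳ a b i | splitAt-↑ˡ a j b = refl

    degree-∪-ˡ : ∀ i → degree (G ∪ H) (i ↑ˡ b) ≡ degree G i
    degree-∪-ˡ i = trans (sum-split a _) (trans
      (cong₂ _+_ (sum-cong-≗ λ j → cong indic (adj-∪-ˡˡ i j))
        (trans (sum-cong-≗ λ j → cong indic (adj-∪-ˡʳ i j)) (ℕSum.sum-replicate-zero b)))
      (ℕₚ.+-identityʳ _))

    degree-∪-ʳ : ∀ i → degree (G ∪ H) (a ↑ʳ i) ≡ degree H i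
    degree-∪-ʳ i = trans (sum-split a _)
      (cong₂ _+_ (trans (sum-cong-≗ λ j → cong indic (adj-∪-ʳˡ i j)) (ℕSum.sum-replicate-zero a))
        (sum-cong-≗ λ j → cong indic (adj-∪-ʳʳ i j)))

  degree-K : ∀ r i → suc (degree (K r) i) ≡ r
  degree-K r i = begin
    1 + degree (K r) i                              ≡⟨ cong (_+ degree (K r) i) (sum-δℕ i) ⟨
    sum (δℕ i) + degree (K r) i                     ≡⟨ ∑-distrib-+ (δℕ i) (λ j → indic (adj (K r) i j)) ⟨
    sum (λ j → δℕ i j + indic (adj (K r) i j))      ≡⟨ sum-cong-≗ (λ j → pointwise ⌊ i ≟ j ⌋) ⟩
    sum {r} (λ _ → 1)                               ≡⟨ trans (sum-const r) (ℕₚ.*-identityʳ r) ⟩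
    r                                               ∎
    where
    open ≡.≡-Reasoning
    pointwise : ∀ b → indic b + indic (not b) ≡ 1
    pointwise true  = refl
    pointwise false = refl

  -- One more than the degree is the size of the component, so the total is a sum of squares.
  sum-degree-K∪K : ∀ ℓ r → sum (suc ∘ degree (K ℓ ∪ K r)) ≡ ℓ * ℓ + r * r
  sum-degree-K∪K ℓ r = trans (sum-split ℓ _) (cong₂ _+_
    (trans (sum-cong-≗ λ i → trans (cong suc (degree-∪-ˡ (K ℓ) (K r) i)) (degree-K ℓ i)) (sum-const ℓ))
    (trans (sum-cong-≗ λ i → trans (cong suc (degree-∪-ʳ (K ℓ) (K r) i)) (degree-K r i)) (sum-const r)))

  sum-suc-degree : ∀ {n} (G H : Graph n) → numEdges H ≡ numEdges G → sum (suc ∘ degree H) ≡ sum (suc ∘ degree G)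
  sum-suc-degree {n} G H e = begin
    sum (suc ∘ degree H)         ≡⟨ sum-suc (degree H) ⟩
    n + sum (degree H)           ≡⟨ cong (n +_) (trans (sum-degree H) (trans (cong₂ _+_ e e) (sym (sum-degree G)))) ⟩
    n + sum (degree G)           ≡⟨ sum-suc (degree G) ⟨
    sum (suc ∘ degree G)         ∎
    where open ≡.≡-Reasoning

  -- The equation reads (ℓ - 1) (r - ℓ - 2) = 2.
  critical-sizes : ∀ ℓ r → .{{_ : ℕ.NonZero ℓ}} → ℓ * r ≡ ℓ * ℓ + ℓ + r → (ℓ ≡ 2 × r ≡ 6) ⊎ (ℓ ≡ 3 × r ≡ 6)
  critical-sizes 1 r e = contradiction (trans (sym (ℕₚ.+-identityʳ r)) e) (ℕₚ.m≢1+n+m r)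
  critical-sizes 2 r e = inj₁ (refl , ℕₚ.+-cancelʳ-≡ r r 6
    (trans (cong (r +_) (sym (ℕₚ.+-identityʳ r))) e))
  critical-sizes 3 r e = inj₂ (refl , ℕₚ.*-cancelˡ-≡ r 6 2 (ℕₚ.+-cancelʳ-≡ r (2 * r) 12
    (trans (ℕₚ.+-comm (2 * r) r) e)))
  -- Here m = ℓ - 1 is at least 3, and the equation becomes mr = m(6 + k) + 2, strictly between two
  -- consecutive multiples of m.
  critical-sizes ℓ@(suc m@(suc (suc (suc k)))) r e = case ℕₚ.≤-<-connex r (6 + k) of λ where
      (inj₁ r≤6+k) → contradiction (ℕₚ.*-monoʳ-≤ m r≤6+k) (ℕₚ.<⇒≱ (ℕₚ.≤-trans
        (ℕₚ.m<m+n (m * (6 + k)) (s≤s z≤n)) (ℕₚ.≤-reflexive (sym mr))))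
      (inj₂ 6+k<r) → contradiction (ℕₚ.*-monoʳ-≤ m 6+k<r) (ℕₚ.<⇒≱ (ℕₚ.≤-trans
        (ℕₚ.≤-reflexive (cong suc mr)) (ℕₚ.≤-trans (ℕₚ.m≤m+n _ k) (ℕₚ.≤-reflexive grow))))
    where
    open +-*-Solver
    mr : m * r ≡ m * (6 + k) + 2
    mr = ℕₚ.+-cancelʳ-≡ r (m * r) _ (trans (ℕₚ.+-comm (m * r) r) (trans e
      (solve 2 (λ k r → (con 4 :+ k) :* (con 4 :+ k) :+ (con 4 :+ k) :+ r
         := (con 3 :+ k) :* (con 6 :+ k) :+ con 2 :+ r) refl k r)))

    grow : suc (m * (6 + k) + 2) + k ≡ m * suc (6 + k)
    grow = solve 1 (λ k → con 1 :+ ((con 3 :+ k) :* (con 6 :+ k) :+ con 2) :+ k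
      := (con 3 :+ k) :* (con 7 :+ k)) refl k

  -- The sum of deg + 2 over H is ℓ² + ℓ + r + r², and low degrees keep it below (ℓ + r)r, so ℓ² + ℓ
  -- + r ≤ ℓr. The numerical hypothesis is the opposite inequality, and equality makes every summand
  -- maximal.
  regular-of-low-degree : ∀ ℓ r (H : Graph (ℓ + r)) → numEdges H ≡ numEdges (K ℓ ∪ K r) →
    (ℓ + r) * ℓ ≤ ℓ + r + 2 * (ℓ * ℓ) → (∀ u → 2 + degree H u ≤ r) →
    ℓ * r ≡ ℓ * ℓ + ℓ + r × (∀ u → 2 + degree H u ≡ r)
  regular-of-low-degree ℓ r H e hyp low = critical , sum-saturated low (begin
      (ℓ + r) * r                        ≡⟨ ℕₚ.*-distribʳ-+ r ℓ r ⟩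
      ℓ * r + r * r                      ≡⟨ cong (_+ r * r) critical ⟩
      ℓ * ℓ + ℓ + r + r * r              ≡⟨ total ⟨
      sum (λ u → 2 + degree H u)         ∎)
    where
    open ℕₚ.≤-Reasoning
    open +-*-Solver using (solve; _:+_; _:*_; _:=_; con)

    total : sum (λ u → 2 + degree H u) ≡ ℓ * ℓ + ℓ + r + r * r
    total = trans (sum-suc (suc ∘ degree H)) (trans
      (cong (ℓ + r +_) (trans (sum-suc-degree (K ℓ ∪ K r) H e) (sum-degree-K∪K ℓ r)))
      (solve 2 (λ ℓ r → ℓ :+ r :+ (ℓ :* ℓ :+ r :* r) := ℓ :* ℓ :+ ℓ :+ r :+ r :* r) refl ℓ r))

    critical : ℓ * r ≡ ℓ * ℓ + ℓ + r
    critical = ℕₚ.≤-antisym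
      (ℕₚ.+-cancelˡ-≤ (ℓ * ℓ) _ _ (begin
        ℓ * ℓ + ℓ * r                  ≡⟨ solve 2 (λ ℓ r → ℓ :* ℓ :+ ℓ :* r := (ℓ :+ r) :* ℓ) refl ℓ r ⟩
        (ℓ + r) * ℓ                    ≤⟨ hyp ⟩
        ℓ + r + 2 * (ℓ * ℓ)            ≡⟨ solve 2 (λ ℓ r → ℓ :+ r :+ con 2 :* (ℓ :* ℓ) := ℓ :* ℓ :+ (ℓ :* ℓ :+ ℓ :+ r)) refl ℓ r ⟩
        ℓ * ℓ + (ℓ * ℓ + ℓ + r)        ∎))
      (ℕₚ.+-cancelʳ-≤ (r * r) _ _ (begin
        ℓ * ℓ + ℓ + r + r * r          ≡⟨ total ⟨
        sum (λ u → 2 + degree H u)     ≤⟨ sum-mono-≤ low ⟩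
        sum {ℓ + r} (λ _ → r)          ≡⟨ sum-const (ℓ + r) ⟩
        (ℓ + r) * r                    ≡⟨ ℕₚ.*-distribʳ-+ r ℓ r ⟩
        ℓ * r + r * r                  ∎))

-- Comparison of largest eigenvalues.

module LargestEigenvalue {c ℓ₁ ℓ₂} (ℝ : RealNumbers c ℓ₁ ℓ₂) where
  open RealNumbers ℝ using (orderedField)
  open OrderedFieldProperties orderedField
  open QuadraticForms orderedField
  open LaplacianForm ℝ
  open RayleighPrinciple ℝ using (rayleigh)
  open GraphCounting
  open Spectrum ℝ using (adjacencyMatrix; laplacian; IsEigenvalue; LEGM)

  module _ {n r} (H : Graph n) (regular : ∀ i → degree H i ≡ r) {μ} (bound : IsUpperBound H μ) where

    -- A triangle of the complement is independent in H, so all 3r edge ends at its corners leave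
    -- it.
    triangle-upperBound : ∀ {i j k} → let G = complement H in
      adj G i j ≡ true → adj G i k ≡ true → adj G j k ≡ true →
      ∀ {e ν} → suc ν ℕ.+ n ℕ.* 9 ≡ n ℕ.* n ℕ.* 3 → e ℕ.* suc ν ℕ.≤ n ℕ.* n ℕ.* (r ℕ.* 3) → fromℕ e ≤ μ
    triangle-upperBound {i} {j} {k} ij ik jk {e} {ν} =
      subset-upperBound H {p = p} p-injective {e = e} {ν} {r ℕ.* 3} bound regular
        (ℕₚ.≤-trans (ℕₚ.+-monoʳ-≤ (r ℕ.* 3) (sum-mono-≤ λ a → sum-mono-≤ λ b → ℕₚ.≤-reflexive (≡.cong indic (independent a b))))
          (ℕₚ.≤-reflexive (ℕₚ.+-identityʳ (r ℕ.* 3))))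
      where
      p : Fin 3 → Fin n
      p 0F = i
      p 1F = j
      p 2F = k

      i≢j = proj₁ (complement-adj H ij)
      i≢k = proj₁ (complement-adj H ik)
      j≢k = proj₁ (complement-adj H jk)

      p-injective : ∀ {a b} → p a ≡ p b → a ≡ b
      p-injective {0F} {0F} _ = ≡.refl
      p-injective {1F} {1F} _ = ≡.refl
      p-injective {2F} {2F} _ = ≡.refl
      p-injective {0F} {1F} e = contradiction e i≢j
      p-injective {0F} {2F} e = contradiction e i≢k
      p-injective {1F} {2F} e = contradiction e j≢k
      p-injective {1F} {0F} e = contradiction (≡.sym e) i≢j
      p-injective {2F} {0F} e = contradiction (≡.sym e) i≢k
      p-injective {2F} {1F} e = contradiction (≡.sym e) j≢k

      independent : ∀ a b → adj H (p a) (p b) ≡ false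
      independent 0F 0F = adj-irrefl H i
      independent 1F 1F = adj-irrefl H j
      independent 2F 2F = adj-irrefl H k
      independent 0F 1F = proj₂ (complement-adj H ij)
      independent 0F 2F = proj₂ (complement-adj H ik)
      independent 1F 2F = proj₂ (complement-adj H jk)
      independent 1F 0F = ≡.trans (adj-sym H j i) (independent 0F 1F)
      independent 2F 0F = ≡.trans (adj-sym H k i) (independent 0F 2F)
      independent 2F 1F = ≡.trans (adj-sym H k j) (independent 1F 2F)

    -- Inside a 4-cycle of the complement, H can have only the two diagonals, which use at most 4 of
    -- the 4r edge ends; `opposite` names the one possible inner neighbour of each corner.
    square-upperBound : ∀ {i j k l} → let G = complement H in i ≢ k → j ≢ l →
      adj G i j ≡ true → adj G k j ≡ true → adj G i l ≡ true → adj G k l ≡ true →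
      ∀ {e ν c} → c ℕ.+ 4 ℕ.≤ r ℕ.* 4 →
      suc ν ℕ.+ n ℕ.* 16 ≡ n ℕ.* n ℕ.* 4 → e ℕ.* suc ν ℕ.≤ n ℕ.* n ℕ.* c → fromℕ e ≤ μ
    square-upperBound {i} {j} {k} {l} i≢k j≢l ij kj il kl {e} {ν} {c} c+4≤ =
      subset-upperBound H {p = p} p-injective {e = e} {ν} {c} bound regular
        (ℕₚ.≤-trans (ℕₚ.+-monoʳ-≤ c (sum-mono-≤ λ a → sum-mono-≤ λ b → edge≤ a b)) c+4≤)
      where
      p : Fin 4 → Fin n
      p 0F = i
      p 1F = j
      p 2F = k
      p 3F = l

      i≢j = proj₁ (complement-adj H ij)
      k≢j = proj₁ (complement-adj H kj)
      i≢l = proj₁ (complement-adj H il)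
      k≢l = proj₁ (complement-adj H kl)

      p-injective : ∀ {a b} → p a ≡ p b → a ≡ b
      p-injective {0F} {0F} _ = ≡.refl
      p-injective {1F} {1F} _ = ≡.refl
      p-injective {2F} {2F} _ = ≡.refl
      p-injective {3F} {3F} _ = ≡.refl
      p-injective {0F} {1F} e = contradiction e i≢j
      p-injective {0F} {2F} e = contradiction e i≢k
      p-injective {0F} {3F} e = contradiction e i≢l
      p-injective {1F} {2F} e = contradiction (≡.sym e) k≢j
      p-injective {1F} {3F} e = contradiction e j≢l
      p-injective {2F} {3F} e = contradiction e k≢l
      p-injective {1F} {0F} e = contradiction (≡.sym e) i≢j
      p-injective {2F} {0F} e = contradiction (≡.sym e) i≢k
      p-injective {3F} {0F} e = contradiction (≡.sym e) i≢l
      p-injective {2F} {1F} e = contradiction e k≢j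
      p-injective {3F} {1F} e = contradiction (≡.sym e) j≢l
      p-injective {3F} {2F} e = contradiction (≡.sym e) k≢l

      opposite : Fin 4 → Fin 4
      opposite 0F = 2F
      opposite 1F = 3F
      opposite 2F = 0F
      opposite 3F = 1F

      absent : ∀ {x y} → adj H x y ≡ false → indic (adj H x y) ℕ.≤ 0
      absent xy = ℕₚ.≤-reflexive (≡.cong indic xy)

      absent′ : ∀ {x y} → adj H x y ≡ false → indic (adj H y x) ℕ.≤ 0
      absent′ {x} {y} xy = absent (≡.trans (adj-sym H y x) xy)

      edge≤ : ∀ a b → indic (adj H (p a) (p b)) ℕ.≤ δℕ (opposite a) b
      edge≤ 0F 0F = absent (adj-irrefl H i)
      edge≤ 1F 1F = absent (adj-irrefl H j)
      edge≤ 2F 2F = absent (adj-irrefl H k)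
      edge≤ 3F 3F = absent (adj-irrefl H l)
      edge≤ 0F 1F = absent (proj₂ (complement-adj H ij))
      edge≤ 1F 0F = absent′ (proj₂ (complement-adj H ij))
      edge≤ 2F 1F = absent (proj₂ (complement-adj H kj))
      edge≤ 1F 2F = absent′ (proj₂ (complement-adj H kj))
      edge≤ 0F 3F = absent (proj₂ (complement-adj H il))
      edge≤ 3F 0F = absent′ (proj₂ (complement-adj H il))
      edge≤ 2F 3F = absent (proj₂ (complement-adj H kl))
      edge≤ 3F 2F = absent′ (proj₂ (complement-adj H kl))
      edge≤ 0F 2F = indic≤1 _
      edge≤ 2F 0F = indic≤1 _
      edge≤ 1F 3F = indic≤1 _
      edge≤ 3F 1F = indic≤1 _

  -- If μ < 6, the complement could contain neither cycle. Here nσ(n - σ) is 8·3·5 = 120 for a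
  -- triangle and 8·4·4 = 128 for a 4-cycle. At least 12 edges leave either set, and the 4-cycle
  -- meets 6·128 = 64·12 exactly.
  quartic-8-upperBound : ∀ (H : Graph 8) → (∀ i → degree H i ≡ 4) → ∀ {μ} → IsUpperBound H μ → fromℕ 6 ≤ μ
  quartic-8-upperBound H regular bound μ<6 = cubic-8-has-short-cycle (complement H) (complement-regular H regular ≡.refl)
    (λ ij ik jk → triangle-upperBound H regular bound ij ik jk {e = 6} {ν = 119} ≡.refl (from-yes (720 ℕₚ.≤? 768)) μ<6)
    (λ i≢k j≢l ij kj il kl → square-upperBound H regular bound i≢k j≢l ij kj il kl {e = 6} {ν = 127} {c = 12}
      (from-yes (16 ℕₚ.≤? 16)) ≡.refl (from-yes (768 ℕₚ.≤? 768)) μ<6)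

  -- Now nσ(n - σ) = 9·3·6 = 162, and 6·162 = 81·12 is again an equality.
  quartic-9-upperBound : ∀ (H : Graph 9) → (∀ i → degree H i ≡ 4) → ∀ {μ} → IsUpperBound H μ → fromℕ 6 ≤ μ
  quartic-9-upperBound H regular bound μ<6 = quartic-9-has-triangle (complement H) (complement-regular H regular ≡.refl)
    (λ ij ik jk → triangle-upperBound H regular bound ij ik jk {e = 6} {ν = 161} ≡.refl (from-yes (972 ℕₚ.≤? 972)) μ<6)

  eigenvalue≤upperBound : ∀ {n} (G : Graph n) {μ x} → IsUpperBound G μ → IsEigenvalue (laplacian G) x → x ≤ μ
  eigenvalue≤upperBound G {μ} {x} bound (v , v≉0 , Lv≈xv) μ<x =
    v≉0 (normSq-zero v λ 0<N → bound v (0<⇒< (*-pos (<⇒0<- μ<x) 0<N) (begin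
      (x - μ) * normSq v           ≈⟨ solve 3 (λ x μ N → (x :- μ) :* N := x :* N :- μ :* N) refl x μ (normSq v) ⟩
      x * normSq v - μ * normSq v  ≈⟨ +-congʳ quad-v ⟨
      quad L v - μ * normSq v      ∎)))
    where
    L = laplacian G

    quad-v : quad L v ≈ x * normSq v
    quad-v = begin
      quad L v                       ≈⟨ dot-cong (λ _ → refl) (λ i → trans (dot≈sum (L i) v) (trans (Lv≈xv i)
                                          (solve 2 (λ x v → x :* v := x :* v :+ #0 :* v) refl x (v i)))) ⟩
      dot v (combine x v 0# v)       ≈⟨ dot-combineʳ v x v 0# v ⟩
      x * normSq v + 0# * normSq v   ≈⟨ solve 2 (λ x N → x :* N :+ #0 :* N := x :* N) refl x (normSq v) ⟩
      x * normSq v                   ∎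

  module _ {a b} (G : Graph a) (H : Graph b) where
    open FiniteSums +-commutativeMonoid

    normSq-split : ∀ v → normSq v ≈ normSq (v ∘ (_↑ˡ b)) + normSq (v ∘ (a ↑ʳ_))
    normSq-split v = trans (dot≈sum v v) (trans (sum-split a _) (sym (+-cong (dot≈sum _ _) (dot≈sum _ _))))

    quad-∪ : ∀ v → quad (laplacian (G ∪ H)) v
                 ≈ quad (laplacian G) (v ∘ (_↑ˡ b)) + quad (laplacian H) (v ∘ (a ↑ʳ_))
    quad-∪ v = begin
      quad (laplacian (G ∪ H)) v
        ≈⟨ quad-laplacian (G ∪ H) v ⟩
      sum (λ i → sum (f i))
        ≈⟨ sum-split a (λ i → sum (f i)) ⟩
      sum (λ i → sum (f (i ↑ˡ b))) + sum (λ i → sum (f (a ↑ʳ i)))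
        ≈⟨ +-cong (sum-cong left) (sum-cong right) ⟩
      sum (λ i → sum λ j → adjacencyMatrix G i j * (v (i ↑ˡ b) * v (i ↑ˡ b) - v (i ↑ˡ b) * v (j ↑ˡ b)))
        + sum (λ i → sum λ j → adjacencyMatrix H i j * (v (a ↑ʳ i) * v (a ↑ʳ i) - v (a ↑ʳ i) * v (a ↑ʳ j)))
        ≈⟨ +-cong (quad-laplacian G _) (quad-laplacian H _) ⟨
      quad (laplacian G) (v ∘ (_↑ˡ b)) + quad (laplacian H) (v ∘ (a ↑ʳ_)) ∎
      where
      f : Fin (a ℕ.+ b) → Fin (a ℕ.+ b) → Carrier
      f i j = adjacencyMatrix (G ∪ H) i j * (v i * v i - v i * v j)

      entry : ∀ {i j} {x : Bool} → adj (G ∪ H) i j ≡ x → f i j ≈ (if x then 1# else 0#) * (v i * v i - v i * v j)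
      entry e = *-congʳ (reflexive (≡.cong (if_then 1# else 0#) e))

      left : ∀ i → sum (f (i ↑ˡ b)) ≈ sum λ j → adjacencyMatrix G i j * (v (i ↑ˡ b) * v (i ↑ˡ b) - v (i ↑ˡ b) * v (j ↑ˡ b))
      left i = trans (sum-split a (f (i ↑ˡ b))) (trans (+-cong (sum-cong λ j → entry (adj-∪-ˡˡ G H i j))
        (trans (sum-cong λ j → trans (entry (adj-∪-ˡʳ G H i j)) (zeroˡ _)) (sum-replicate-zero b))) (+-identityʳ _))

      right : ∀ i → sum (f (a ↑ʳ i)) ≈ sum λ j → adjacencyMatrix H i j * (v (a ↑ʳ i) * v (a ↑ʳ i) - v (a ↑ʳ i) * v (a ↑ʳ j))
      right i = trans (sum-split a (f (a ↑ʳ i))) (trans (+-cong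
        (trans (sum-cong λ j → trans (entry (adj-∪-ʳˡ G H i j)) (zeroˡ _)) (sum-replicate-zero a))
        (sum-cong λ j → entry (adj-∪-ʳʳ G H i j))) (+-identityˡ _))

    upperBound-∪ : ∀ {μ} → IsUpperBound G μ → IsUpperBound H μ → IsUpperBound (G ∪ H) μ
    upperBound-∪ {μ} boundG boundH v = ≤-respˡ (sym (quad-∪ v))
      (≤-respʳ (trans (sym (distribˡ μ _ _)) (*-congˡ (sym (normSq-split v))))
        (+-mono-≤ (boundG (v ∘ (_↑ˡ b))) (boundH (v ∘ (a ↑ʳ_)))))

  quad-K : ∀ r v → quad (laplacian (K r)) v ≈ fromℕ r * normSq v - sum v * sum v
  quad-K r v = begin
    dot v (apply (laplacian (K r)) v)
      ≈⟨ dot-cong (λ _ → refl) row ⟩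
    dot v (combine (fromℕ r) v (- sum v) ones)
      ≈⟨ dot-combineʳ v (fromℕ r) v (- sum v) ones ⟩
    fromℕ r * normSq v + - sum v * dot v ones
      ≈⟨ +-congˡ (*-congˡ (dot-ones v)) ⟩
    fromℕ r * normSq v + - sum v * sum v
      ≈⟨ solve 2 (λ x s → x :+ :- s :* s := x :- s :* s) refl (fromℕ r * normSq v) (sum v) ⟩
    fromℕ r * normSq v - sum v * sum v ∎
    where
    entry : ∀ i j → adjacencyMatrix (K r) i j ≈ 1# * 1# + - 1# * δ i j
    entry i j with i ≟ j
    ... | yes _ = solve 0 (#0 := #1 :* #1 :+ :- #1 :* #1) refl
    ... | no _  = solve 0 (#1 := #1 :* #1 :+ :- #1 :* #0) refl

    row : ∀ i → apply (laplacian (K r)) v i ≈ fromℕ r * v i + - sum v * 1#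
    row i = begin
      apply (laplacian (K r)) v i
        ≈⟨ apply-laplacian (K r) v i ⟩
      fromℕ (degree (K r) i) * v i - dot (adjacencyMatrix (K r) i) v
        ≈⟨ +-congˡ (-‿cong (trans (dot-cong (entry i) (λ _ → refl)) (dot-combineˡ v 1# ones (- 1#) (δ i)))) ⟩
      fromℕ (degree (K r) i) * v i - (1# * dot ones v + - 1# * dot (δ i) v)
        ≈⟨ +-congˡ (-‿cong (+-cong (*-congˡ (trans (dot-comm ones v) (dot-ones v))) (*-congˡ (dot-δ i v)))) ⟩
      fromℕ (degree (K r) i) * v i - (1# * sum v + - 1# * v i)
        ≈⟨ solve 3 (λ d v s → d :* v :- (#1 :* s :+ :- #1 :* v) := (#1 :+ d) :* v :+ :- s :* #1)
             refl (fromℕ (degree (K r) i)) (v i) (sum v) ⟩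
      fromℕ (suc (degree (K r) i)) * v i + - sum v * 1#
        ≈⟨ +-congʳ (*-congʳ (fromℕ-cong (degree-K r i))) ⟩
      fromℕ r * v i + - sum v * 1# ∎

  upperBound-K : ∀ {ℓ r} → ℓ ℕ.≤ r → IsUpperBound (K ℓ) (fromℕ r)
  upperBound-K {ℓ} {r} ℓ≤r v = ≤-trans
    (0≤⇒≤ (square-nonneg (sum v)) (trans
      (solve 2 (λ x s → s :* s := x :- (x :- s :* s)) refl (fromℕ ℓ * normSq v) (sum v))
      (+-congˡ (-‿cong (sym (quad-K ℓ v))))))
    (≤-*-nonneg (normSq-nonneg v) (fromℕ-mono-≤ ℓ≤r))

  -- Serves the case of two vertices, where the general bound r = 1 for the union exceeds the true
  -- value 0.
  upperBound-K₁ : IsUpperBound (K 1) 0#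
  upperBound-K₁ v = ≤-reflexive (begin
    quad (laplacian (K 1)) v               ≈⟨ quad-K 1 v ⟩
    fromℕ 1 * normSq v - sum v * sum v     ≈⟨ +-congʳ (*-congˡ (trans (normSq-∷ v) (+-congˡ (dot-[] _ _)))) ⟩
    fromℕ 1 * (v zero * v zero + 0#) - sum v * sum v
      ≈⟨ solve 2 (λ x N → numeral 1 :* (x :* x :+ #0) :- (x :+ #0) :* (x :+ #0) := #0 :* N) refl (v zero) (normSq v) ⟩
    0# * normSq v                          ∎)

  -- With `ℓ` and `r` variable, matching on the equations turns `H` into a graph on 8 concrete
  -- vertices.
  quartic-8 : ∀ {ℓ r} → ℓ ≡ 2 → r ≡ 6 → (H : Graph (ℓ ℕ.+ r)) → (∀ u → 2 ℕ.+ degree H u ≡ r) →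
    ∀ {μ} → IsUpperBound H μ → fromℕ r ≤ μ
  quartic-8 ≡.refl ≡.refl H regular = quartic-8-upperBound H (λ u → ℕₚ.+-cancelˡ-≡ 2 _ 4 (regular u))

  quartic-9 : ∀ {ℓ r} → ℓ ≡ 3 → r ≡ 6 → (H : Graph (ℓ ℕ.+ r)) → (∀ u → 2 ℕ.+ degree H u ≡ r) →
    ∀ {μ} → IsUpperBound H μ → fromℕ r ≤ μ
  quartic-9 ≡.refl ≡.refl H regular = quartic-9-upperBound H (λ u → ℕₚ.+-cancelˡ-≡ 2 _ 4 (regular u))

  disjoint-complete-LEGM : ∀ ℓ r → .{{_ : ℕ.NonZero ℓ}} → ℓ ℕ.≤ r →
    (ℓ ℕ.+ r) ℕ.* ℓ ℕ.≤ ℓ ℕ.+ r ℕ.+ 2 ℕ.* (ℓ ℕ.* ℓ) → LEGM (K ℓ ∪ K r)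
  -- With r = 1 the degree criterion would have to apply at degree 0, where it fails; instead x ≤ 0
  -- ≤ y by semidefiniteness.
  disjoint-complete-LEGM (suc zero) (suc zero) _ _ H edges {x} {y} (x-eigenvalue , _) (_ , y-largest) =
    ≤-trans (eigenvalue≤upperBound (K 1 ∪ K 1) (upperBound-∪ (K 1) (K 1) upperBound-K₁ upperBound-K₁) x-eigenvalue)
      (upperBound-nonneg H zero (rayleigh (laplacian-sym H) y-largest))
  disjoint-complete-LEGM (suc (suc _)) (suc zero) (s≤s ())
  disjoint-complete-LEGM ℓ@(suc _) r@(suc (suc k)) ℓ≤r hyp H edges {x} {y} (x-eigenvalue , _) (_ , y-largest) =
    ≤-trans (eigenvalue≤upperBound (K ℓ ∪ K r) (upperBound-∪ (K ℓ) (K r) (upperBound-K ℓ≤r) (upperBound-K ℕₚ.≤-refl)) x-eigenvalue)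
      r≤y
    where
    bound : IsUpperBound H y
    bound = rayleigh (laplacian-sym H) y-largest

    r≤y : fromℕ r ≤ y
    r≤y with any? (λ u → r ℕₚ.≤? suc (degree H u))
    -- Since r is at least 2, the degree of `u` is positive, as `degree<upperBound` demands.
    ... | yes (u , r≤1+d) = ≤-trans (fromℕ-mono-≤ r≤1+d)
      (degree<upperBound H bound u (ℕₚ.≤-trans (s≤s z≤n) (ℕ.s≤s⁻¹ r≤1+d)))
    ... | no low =
      let critical , regular = regular-of-low-degree ℓ r H edges hyp (λ u → ℕₚ.≰⇒> λ r≤1+d → low (u , r≤1+d))
      in [ (λ (ℓ≡2 , r≡6) → quartic-8 ℓ≡2 r≡6 H regular bound) , (λ (ℓ≡3 , r≡6) → quartic-9 ℓ≡3 r≡6 H regular bound) ]′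
           (critical-sizes ℓ r critical)

-- From the rational hypotheses to natural numbers.

open import Data.Integer.Base using (+_)
open import Data.Nat.Base using (_∸_; _*_; _^_)
open import Data.Rational.Unnormalised.Base using (_/_; _-_; _≤_; 1ℚᵘ; *≤*)

half-bound : ∀ {n ℓ} → + ℓ / 1 ≤ + n / 2 → 2 * ℓ ℕ.≤ n
half-bound {n} {ℓ} (*≤* p) = ℤₚ.drop‿+≤+ (begin
  + (2 * ℓ)        ≡⟨ ≡.cong +_ (ℕₚ.*-comm 2 ℓ) ⟩
  + (ℓ * 2)        ≡⟨ ℤₚ.pos-* ℓ 2 ⟩
  + ℓ ℤ.* + 2      ≤⟨ p ⟩
  + n ℤ.* + 1      ≡⟨ ℤₚ.*-identityʳ (+ n) ⟩
  + n              ∎)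
  where open ℤₚ.≤-Reasoning

-- `*≤*` holds the cross-multiplied integer inequality; moving 2ℓ² to the right removes the
-- subtraction, so that it descends to `ℕ`.
defect-bound : ∀ {n ℓ} .{{_ : NonZero n}} → + ℓ / 1 - + (2 * ℓ ^ 2) / n ≤ 1ℚᵘ → n * ℓ ℕ.≤ n ℕ.+ 2 * (ℓ * ℓ)
defect-bound {n@(suc m)} {ℓ} (*≤* p) = ℤₚ.drop‿+≤+ (begin
  + (n * ℓ)
    ≡⟨ ℤₚ.pos-* n ℓ ⟩
  + n ℤ.* + ℓ
    ≡⟨ solve 3 (λ n ℓ s → n :* ℓ := (ℓ :* n :+ (:- s) :* con (+ 1)) :* con (+ 1) :+ s) ≡.refl (+ n) (+ ℓ) (+ (2 * ℓ ^ 2)) ⟩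
  (+ ℓ ℤ.* + n ℤ.+ ℤ.- (+ (2 * ℓ ^ 2)) ℤ.* + 1) ℤ.* + 1 ℤ.+ + (2 * ℓ ^ 2)
    ≤⟨ ℤₚ.+-monoˡ-≤ (+ (2 * ℓ ^ 2)) p ⟩
  + 1 ℤ.* + (1 * n) ℤ.+ + (2 * ℓ ^ 2)
    ≡⟨ ≡.cong₂ ℤ._+_ (≡.trans (ℤₚ.*-identityˡ _) (≡.cong +_ (ℕₚ.*-identityˡ n)))
         (≡.cong (λ s → + (2 * (ℓ * s))) (ℕₚ.*-identityʳ ℓ)) ⟩
  + (n ℕ.+ 2 * (ℓ * ℓ)) ∎)
  where
  open ℤₚ.≤-Reasoning
  open ℤ-Solver.+-*-Solver

theorem4p1 : ∀ {c ℓ₁ ℓ₂} (ℝ : RealNumbers c ℓ₁ ℓ₂)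
    (n ℓ : ℕ) .{{_ : NonZero n}} .{{_ : NonZero ℓ}} →
    + ℓ / 1 ≤ + n / 2 →
    + ℓ / 1 - + (2 * ℓ ^ 2) / n ≤ 1ℚᵘ →
    Spectrum.LEGM ℝ (K ℓ ∪ K (n ∸ ℓ))
theorem4p1 ℝ n ℓ half defect = LargestEigenvalue.disjoint-complete-LEGM ℝ ℓ (n ∸ ℓ)
  (ℕₚ.m+n≤o⇒m≤o∸n ℓ ℓ+ℓ≤n)
  (≡.subst (λ k → k * ℓ ℕ.≤ k ℕ.+ 2 * (ℓ * ℓ)) (≡.sym (ℕₚ.m+[n∸m]≡n (ℕₚ.m+n≤o⇒m≤o ℓ ℓ+ℓ≤n))) (defect-bound defect))
  where
  ℓ+ℓ≤n : ℓ ℕ.+ ℓ ℕ.≤ n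
  ℓ+ℓ≤n = ≡.subst (ℕ._≤ n) (≡.cong (ℓ ℕ.+_) (ℕₚ.+-identityʳ ℓ)) (half-bound half)
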